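{- Let $\lambda$ be a partition and $k\ge 0$ an integer. For a cell $(i,j)\in\lambda$ (row $i$, column $j$) let $\lambda/(i,j)$ be the partition obtained from $\lambda$ by removing its $i$th row and its $j$th column. Then \[ \sum_{(i,j)\in\lambda} q^{\,i-j+\lambda_i}\,R_k\big(\lambda/(i,j)\big)=q\,[k+1]\,R_{k+1}(\lambda). \]
   Context: $q$ is an indeterminate and $[x]=(1-q^x)/(1-q)$ for integers $x$. A partition $\lambda$ is identified with its Ferrers board of cells $(i,j)$, $1\le j\le\lambda_i$, rows numbered from the top and columns from the left. The Garsia–Remmel $q$-rook number $R_k(\lambda)=\sum_p q^{\mathrm{inv}(p)}$, summed over placements $p$ of $k$ non-attacking rooks on cells of $\lambda$, where $\mathrm{inv}(p)$ is the number of cells of $\lambda$ that contain no rook, are not to the left of a rook in the same row, and are not above a rook in the same column. -}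

module Defs where

open import Data.Nat using (ℕ; zero; suc; _+_; _*_; _∸_; _≤_; _≥_; _≡ᵇ_; _<ᵇ_)
open import Data.Bool using () renaming (_≟_ to _≟B_)
open import Data.Bool using (Bool; true; false; _∧_; _∨_; not; if_then_else_)
open import Data.List using (List; []; _∷_; _++_; map; foldr; length; filter; upTo; replicate; concatMap)
open import Data.List.Relation.Unary.All using (All)
open import Data.List.Relation.Unary.Linked using (Linked)
open import Data.Product using (_×_; _,_; proj₁; proj₂)
open import Relation.Binary.PropositionalEquality using (_≡_)
open import Relation.Nullary.Decidable using (does)
open import Data.Nat using (_≟_; _≤?_; _≤ᵇ_)

-- Polynomials in q with coefficients in ℕ, as coefficient lists
-- (head = constant term).  Equality is coefficientwise.

Poly : Set
Poly = List ℕ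

coeff : Poly → ℕ → ℕ
coeff []       _       = 0
coeff (a ∷ p)  zero    = a
coeff (a ∷ p)  (suc n) = coeff p n

_≈_ : Poly → Poly → Set
p ≈ r = ∀ n → coeff p n ≡ coeff r n

infix 4 _≈_
infixl 6 _+ₚ_
infixl 7 _*ₚ_

_+ₚ_ : Poly → Poly → Poly
[]      +ₚ r       = r
(a ∷ p) +ₚ []      = a ∷ p
(a ∷ p) +ₚ (b ∷ r) = (a + b) ∷ (p +ₚ r)

scale : ℕ → Poly → Poly
scale c = map (c *_)

_*ₚ_ : Poly → Poly → Poly
[]      *ₚ r = []
(a ∷ p) *ₚ r = scale a r +ₚ (0 ∷ (p *ₚ r))

qpow : ℕ → Poly
qpow n = replicate n 0 ++ (1 ∷ [])

sumₚ : List Poly → Poly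
sumₚ = foldr _+ₚ_ []

qint : ℕ → Poly
qint n = sumₚ (map qpow (upTo n))

IsPartition : List ℕ → Set
IsPartition λs = All (1 ≤_) λs × Linked _≥_ λs

-- Cells (i , j), rows i and columns j numbered from 1.
Cell : Set
Cell = ℕ × ℕ

cellsFrom : ℕ → List ℕ → List Cell
cellsFrom i []        = []
cellsFrom i (l ∷ ls)  = map (λ j → (i , suc j)) (upTo l) ++ cellsFrom (suc i) ls

cells : List ℕ → List Cell
cells = cellsFrom 1

-- λ_i (1-indexed; 0 if out of range)
part : List ℕ → ℕ → ℕ
part []       _             = 0
part (l ∷ ls) zero          = 0
part (l ∷ ls) (suc zero)    = l
part (l ∷ ls) (suc (suc i)) = part ls (suc i)

deleteRow : ℕ → List ℕ → List ℕ
deleteRow _             []       = []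
deleteRow zero          ls       = ls
deleteRow (suc zero)    (l ∷ ls) = ls
deleteRow (suc (suc i)) (l ∷ ls) = l ∷ deleteRow (suc i) ls

deleteCol : ℕ → List ℕ → List ℕ
deleteCol j = map (λ l → if j ≤ᵇ l then l ∸ 1 else l)

dropZeros : List ℕ → List ℕ
dropZeros = filter (λ l → 1 ≤? l)

removeRC : List ℕ → Cell → List ℕ
removeRC λs (i , j) = dropZeros (deleteCol j (deleteRow i λs))

sublists : {A : Set} → List A → List (List A)
sublists []       = [] ∷ []
sublists (x ∷ xs) = let s = sublists xs in map (x ∷_) s ++ s

cellEq : Cell → Cell → Bool
cellEq (a , b) (c , d) = (a ≡ᵇ c) ∧ (b ≡ᵇ d)

anyB : {A : Set} → (A → Bool) → List A → Bool
anyB f = foldr (λ x b → f x ∨ b) false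

allB : {A : Set} → (A → Bool) → List A → Bool
allB f = foldr (λ x b → f x ∧ b) true

attacks : Cell → Cell → Bool
attacks (a , b) (c , d) = (a ≡ᵇ c) ∨ (b ≡ᵇ d)

nonAttacking : List Cell → Bool
nonAttacking []       = true
nonAttacking (r ∷ rs) = not (anyB (attacks r) rs) ∧ nonAttacking rs

placements : ℕ → List ℕ → List (List Cell)
placements k λs =
  filter (λ p → length p ≟ k) (filter (λ p → nonAttacking p ≟B true) (sublists (cells λs)))

-- a cell c is counted by inv(p) iff it contains no rook, is not to the left
-- of a rook in the same row, and is not above a rook in the same column
counted : List Cell → Cell → Bool
counted p (i , j) =
  not (anyB (cellEq (i , j)) p)
  ∧ not (anyB (λ r → (proj₁ r ≡ᵇ i) ∧ (j <ᵇ proj₂ r)) p)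
  ∧ not (anyB (λ r → (proj₂ r ≡ᵇ j) ∧ (i <ᵇ proj₁ r)) p)

inv : List ℕ → List Cell → ℕ
inv λs p = length (filter (λ c → counted p c ≟B true) (cells λs))

R : ℕ → List ℕ → Poly
R k λs = sumₚ (map (λ p → qpow (inv λs p)) (placements k λs))

lhs : ℕ → List ℕ → Poly
lhs k λs = sumₚ (map (λ c → qpow ((proj₁ c + part λs (proj₁ c)) ∸ proj₂ c) *ₚ R k (removeRC λs c)) (cells λs))

-- A full row of m cells placed above a board B that lies within its columns gives the rook recurrence
-- R_k = q^(m-k) R_k(B) + [m-k+1] R_(k-1)(B): a rook in the new row has m-k+1 free columns, and counting
-- the free cells to its right over these choices gives [m-k+1]. Applied to the top row of a partition, and
-- after transposition to its first column, it removes a row or a column.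
--
-- Induct on the number of columns, writing λ as μ (with ℓ rows) plus a first column. The cells (i,1)
-- contribute the sum over i of q^(i+μ_i) R_k(μ without row i), which is q^(k+1) [ℓ-k] R_k(μ) by
-- induction on the rows. For the other cells, λ/(i,j+1) is μ/(i,j) plus a first column, so the column
-- recurrence expresses their contribution through the identity for μ at k and at k-1. The column
-- recurrence for λ itself then reassembles q [k+1] R_(k+1)(λ).

module Submission where

open import Defs
open import Algebra.Bundles using (CommutativeMonoid; CommutativeSemiring)
import Algebra.Properties.CommutativeSemigroup as CommutativeSemigroupProperties
import Algebra.Solver.Ring.NaturalCoefficients.Default as NaturalCoefficientSolver
open import Data.Bool using () renaming (_≟_ to _≟B_)
open import Data.Bool using (Bool; true; false; _∧_; _∨_; not; if_then_else_; T)
open import Data.Bool.Properties using (∨-zeroʳ; ∨-identityʳ; ∨-comm; ∧-comm; ∧-zeroʳ; ∧-identityʳ; ∧-assoc)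
open import Data.List using (List; []; _∷_; _++_; map; foldr; length; filter; upTo; applyUpTo)
open import Data.List.Properties using (map-++; map-∘; length-map; upTo-∷ʳ; map-applyUpTo; ++-identityʳ; filter-all; filter-none; filter-++)
open import Data.Empty using (⊥-elim)
open import Data.List.Membership.Propositional using (_∈_)
open import Data.List.Relation.Unary.All as All using (All; []; _∷_)
import Data.List.Relation.Unary.All.Properties as All
open import Data.List.Relation.Unary.AllPairs as AllPairs using (AllPairs; []; _∷_)
open import Data.List.Relation.Unary.Linked.Properties using (Linked⇒AllPairs)
import Data.List.Relation.Unary.AllPairs.Properties as AllPairs
open import Data.List.Relation.Unary.Any using (here; there)
open import Data.List.Relation.Binary.Permutation.Propositional as ↭ using (_↭_)
open import Data.List.Relation.Binary.Permutation.Propositional.Properties using (↭-length; ++⁺ˡ; shifts)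
open import Data.Nat using (ℕ; zero; suc; pred; _⊔_; _+_; _*_; _∸_; _≤_; _<_; _≥_; s≤s; z≤n; z<s)
open import Data.Nat using (_≟_; _≤?_; _≡ᵇ_; _<ᵇ_; _≤ᵇ_)
open import Data.Nat.Properties
open import Data.Product using (Σ; _×_; _,_; proj₁; proj₂)
open import Function using (_∘_; id)
open import Relation.Nullary using (Dec; yes; no)
open import Relation.Nullary.Decidable using (does)
open import Level using (0ℓ)
open import Relation.Unary using (Pred; Decidable)
open import Relation.Binary.Bundles using (Setoid)
open import Relation.Binary.PropositionalEquality using (_≡_; refl; sym; trans; cong; cong₂; subst; module ≡-Reasoning)
open import Relation.Binary.Structures using (IsEquivalence)
import Relation.Binary.Reasoning.Setoid as SetoidReasoning

-- _≈_ is a function type, from which Agda cannot recover the two polynomials; wrapping it in a record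
-- makes them inferable.
record _≋_ (p r : Poly) : Set where
  constructor mk≋
  field coeff-≡ : p ≈ r
open _≋_ public
infix 4 _≋_

open import Algebra.Structures _≋_ using (IsCommutativeMonoid)
open import Algebra.Structures.Biased _≋_ using (IsCommutativeMonoidʳ; isCommutativeMonoidʳ; IsCommutativeSemiringˡ)

≋-refl : ∀ {p} → p ≋ p
≋-refl = mk≋ λ _ → refl

≋-sym : ∀ {p r} → p ≋ r → r ≋ p
≋-sym (mk≋ e) = mk≋ λ n → sym (e n)

≋-trans : ∀ {p r s} → p ≋ r → r ≋ s → p ≋ s
≋-trans (mk≋ e) (mk≋ f) = mk≋ λ n → trans (e n) (f n)

≡⇒≋ : ∀ {p r} → p ≡ r → p ≋ r
≡⇒≋ refl = ≋-refl

≋-isEquivalence : IsEquivalence _≋_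
≋-isEquivalence = record { refl = ≋-refl ; sym = ≋-sym ; trans = ≋-trans }

≋-setoid : Setoid _ _
≋-setoid = record { isEquivalence = ≋-isEquivalence }

module ≋-Reasoning = SetoidReasoning ≋-setoid

coeff-+ₚ : ∀ p r n → coeff (p +ₚ r) n ≡ coeff p n + coeff r n
coeff-+ₚ []      r       n       = refl
coeff-+ₚ (a ∷ p) []      n       = sym (+-identityʳ _)
coeff-+ₚ (a ∷ p) (b ∷ r) zero    = refl
coeff-+ₚ (a ∷ p) (b ∷ r) (suc n) = coeff-+ₚ p r n

coeff-scale : ∀ c p n → coeff (scale c p) n ≡ c * coeff p n
coeff-scale c []      n       = sym (*-zeroʳ c)
coeff-scale c (a ∷ p) zero    = refl
coeff-scale c (a ∷ p) (suc n) = coeff-scale c p n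

∷-cong : ∀ {a b p r} → a ≡ b → p ≋ r → a ∷ p ≋ b ∷ r
∷-cong a≡b (mk≋ e) = mk≋ λ { zero → a≡b ; (suc n) → e n }

∷-tail : ∀ {a b p r} → a ∷ p ≋ b ∷ r → p ≋ r
∷-tail (mk≋ e) = mk≋ λ n → e (suc n)

0∷-zero : ∀ {p} → p ≋ [] → 0 ∷ p ≋ []
0∷-zero (mk≋ e) = mk≋ λ { zero → refl ; (suc n) → e n }

+ₚ-cong : ∀ {p p′ r r′} → p ≋ p′ → r ≋ r′ → p +ₚ r ≋ p′ +ₚ r′
+ₚ-cong {p} {p′} {r} {r′} (mk≋ e) (mk≋ f) = mk≋ λ n → begin
  coeff (p +ₚ r) n         ≡⟨ coeff-+ₚ p r n ⟩
  coeff p n + coeff r n    ≡⟨ cong₂ _+_ (e n) (f n) ⟩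
  coeff p′ n + coeff r′ n  ≡⟨ coeff-+ₚ p′ r′ n ⟨
  coeff (p′ +ₚ r′) n       ∎
  where open ≡-Reasoning

+ₚ-congˡ : ∀ p {r r′} → r ≋ r′ → p +ₚ r ≋ p +ₚ r′
+ₚ-congˡ p = +ₚ-cong {p} ≋-refl

+ₚ-comm : ∀ p r → p +ₚ r ≋ r +ₚ p
+ₚ-comm p r = mk≋ λ n → trans (coeff-+ₚ p r n) (trans (+-comm (coeff p n) _) (sym (coeff-+ₚ r p n)))

+ₚ-assoc : ∀ p r s → (p +ₚ r) +ₚ s ≋ p +ₚ (r +ₚ s)
+ₚ-assoc p r s = mk≋ coeffwise
  where
  coeffwise : ∀ n → coeff ((p +ₚ r) +ₚ s) n ≡ coeff (p +ₚ (r +ₚ s)) n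
  coeffwise n rewrite coeff-+ₚ (p +ₚ r) s n | coeff-+ₚ p r n | coeff-+ₚ p (r +ₚ s) n | coeff-+ₚ r s n =
    +-assoc (coeff p n) _ _

+ₚ-identityʳ : ∀ p → p +ₚ [] ≋ p
+ₚ-identityʳ p = mk≋ λ n → trans (coeff-+ₚ p [] n) (+-identityʳ _)

+ₚ-isCommutativeMonoid : IsCommutativeMonoid _+ₚ_ []
+ₚ-isCommutativeMonoid = isCommutativeMonoidʳ record
  { isSemigroup = record { isMagma = record { isEquivalence = ≋-isEquivalence ; ∙-cong = +ₚ-cong } ; assoc = +ₚ-assoc }
  ; identityʳ   = +ₚ-identityʳ
  ; comm        = +ₚ-comm
  }

+ₚ-commutativeMonoid : CommutativeMonoid _ _
+ₚ-commutativeMonoid = record { isCommutativeMonoid = +ₚ-isCommutativeMonoid }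

open CommutativeSemigroupProperties (CommutativeMonoid.commutativeSemigroup +ₚ-commutativeMonoid)
  using () renaming (interchange to +ₚ-interchange; x∙yz≈y∙xz to +ₚ-exchange)

scale-+ₚ : ∀ c p r → scale c (p +ₚ r) ≋ scale c p +ₚ scale c r
scale-+ₚ c p r = mk≋ coeffwise
  where
  coeffwise : ∀ n → coeff (scale c (p +ₚ r)) n ≡ coeff (scale c p +ₚ scale c r) n
  coeffwise n rewrite coeff-scale c (p +ₚ r) n | coeff-+ₚ p r n | coeff-+ₚ (scale c p) (scale c r) n
    | coeff-scale c p n | coeff-scale c r n = *-distribˡ-+ c (coeff p n) _

+-scale : ∀ a b p → scale (a + b) p ≋ scale a p +ₚ scale b p
+-scale a b p = mk≋ coeffwise
  where
  coeffwise : ∀ n → coeff (scale (a + b) p) n ≡ coeff (scale a p +ₚ scale b p) n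
  coeffwise n rewrite coeff-scale (a + b) p n | coeff-+ₚ (scale a p) (scale b p) n
    | coeff-scale a p n | coeff-scale b p n = *-distribʳ-+ (coeff p n) a b

*-scale : ∀ a b p → scale a (scale b p) ≋ scale (a * b) p
*-scale a b p = mk≋ coeffwise
  where
  coeffwise : ∀ n → coeff (scale a (scale b p)) n ≡ coeff (scale (a * b) p) n
  coeffwise n rewrite coeff-scale a (scale b p) n | coeff-scale b p n | coeff-scale (a * b) p n =
    sym (*-assoc a b _)

scale-zero : ∀ p → scale 0 p ≋ []
scale-zero p = mk≋ (coeff-scale 0 p)

scale-one : ∀ p → scale 1 p ≋ p
scale-one p = mk≋ λ n → trans (coeff-scale 1 p n) (+-identityʳ _)

*ₚ-zeroʳ : ∀ p → p *ₚ [] ≋ []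
*ₚ-zeroʳ []      = ≋-refl
*ₚ-zeroʳ (a ∷ p) = 0∷-zero (*ₚ-zeroʳ p)

0∷-*ₚ : ∀ p r → (0 ∷ p) *ₚ r ≋ 0 ∷ (p *ₚ r)
0∷-*ₚ p r = +ₚ-cong (scale-zero r) ≋-refl

*ₚ-annihilatedˡ : ∀ {p} r → p ≋ [] → p *ₚ r ≋ []
*ₚ-annihilatedˡ {[]}    r _ = ≋-refl
*ₚ-annihilatedˡ {a ∷ p} r (mk≋ e) rewrite e 0 =
  ≋-trans (0∷-*ₚ p r) (0∷-zero (*ₚ-annihilatedˡ {p} r (mk≋ λ n → e (suc n))))

*ₚ-congʳ : ∀ {p p′} r → p ≋ p′ → p *ₚ r ≋ p′ *ₚ r
*ₚ-congʳ {[]}    {p′}     r e = ≋-sym (*ₚ-annihilatedˡ r (≋-sym e))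
*ₚ-congʳ {a ∷ p} {[]}     r e = *ₚ-annihilatedˡ r e
*ₚ-congʳ {a ∷ p} {b ∷ p′} r e@(mk≋ e′) =
  +ₚ-cong (≡⇒≋ (cong (λ c → scale c r) (e′ 0))) (∷-cong refl (*ₚ-congʳ r (∷-tail e)))

*ₚ-distribʳ : ∀ s p r → (p +ₚ r) *ₚ s ≋ p *ₚ s +ₚ r *ₚ s
*ₚ-distribʳ s []      r       = ≋-refl
*ₚ-distribʳ s (a ∷ p) []      = ≋-sym (+ₚ-identityʳ _)
*ₚ-distribʳ s (a ∷ p) (b ∷ r) = ≋-trans (+ₚ-cong (+-scale a b s) (∷-cong refl (*ₚ-distribʳ s p r)))
  (+ₚ-interchange (scale a s) (scale b s) (0 ∷ (p *ₚ s)) (0 ∷ (r *ₚ s)))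

*ₚ-∷ʳ : ∀ r a p → r *ₚ (a ∷ p) ≋ scale a r +ₚ (0 ∷ (r *ₚ p))
*ₚ-∷ʳ []      a p = ≋-sym (0∷-zero ≋-refl)
*ₚ-∷ʳ (b ∷ r) a p = ∷-cong (cong (_+ 0) (*-comm b a))
  (≋-trans (+ₚ-cong ≋-refl (*ₚ-∷ʳ r a p)) (+ₚ-exchange (scale b p) (scale a r) _))

*ₚ-comm : ∀ p r → p *ₚ r ≋ r *ₚ p
*ₚ-comm []      r = ≋-sym (*ₚ-zeroʳ r)
*ₚ-comm (a ∷ p) r = ≋-trans (+ₚ-cong ≋-refl (∷-cong refl (*ₚ-comm p r))) (≋-sym (*ₚ-∷ʳ r a p))

*ₚ-cong : ∀ {p p′ r r′} → p ≋ p′ → r ≋ r′ → p *ₚ r ≋ p′ *ₚ r′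
*ₚ-cong {p} {p′} {r} {r′} e f = ≋-trans (*ₚ-congʳ r e)
  (≋-trans (*ₚ-comm p′ r) (≋-trans (*ₚ-congʳ p′ f) (*ₚ-comm r′ p′)))

*ₚ-congˡ : ∀ p {r r′} → r ≋ r′ → p *ₚ r ≋ p *ₚ r′
*ₚ-congˡ p = *ₚ-cong {p} ≋-refl

*ₚ-vanishing : ∀ {r} → r ≋ [] → ∀ p → p *ₚ r ≋ []
*ₚ-vanishing r≋0 p = ≋-trans (*ₚ-congˡ p r≋0) (*ₚ-zeroʳ p)

scale-*ₚ : ∀ a r s → scale a r *ₚ s ≋ scale a (r *ₚ s)
scale-*ₚ a []      s = ≋-refl
scale-*ₚ a (b ∷ r) s = ≋-trans (+ₚ-cong (≋-sym (*-scale a b s)) (∷-cong (sym (*-zeroʳ a)) (scale-*ₚ a r s)))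
  (≋-sym (scale-+ₚ a (scale b s) (0 ∷ (r *ₚ s))))

*ₚ-assoc : ∀ p r s → (p *ₚ r) *ₚ s ≋ p *ₚ (r *ₚ s)
*ₚ-assoc []      r s = ≋-refl
*ₚ-assoc (a ∷ p) r s = ≋-trans (*ₚ-distribʳ s (scale a r) (0 ∷ (p *ₚ r)))
  (+ₚ-cong (scale-*ₚ a r s) (≋-trans (0∷-*ₚ (p *ₚ r) s) (∷-cong refl (*ₚ-assoc p r s))))

*ₚ-identityˡ : ∀ p → qpow 0 *ₚ p ≋ p
*ₚ-identityˡ p = ≋-trans (+ₚ-cong (scale-one p) (0∷-zero ≋-refl)) (+ₚ-identityʳ p)

polyCommutativeSemiring : CommutativeSemiring _ _
polyCommutativeSemiring = record
  { isCommutativeSemiring = IsCommutativeSemiringˡ.isCommutativeSemiring record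
    { +-isCommutativeMonoid = +ₚ-isCommutativeMonoid
    ; *-isCommutativeMonoid = IsCommutativeMonoidʳ.isCommutativeMonoid *ₚ-isCommutativeMonoidʳ
    ; distribʳ              = *ₚ-distribʳ
    ; zeroˡ                 = λ _ → ≋-refl
    }
  }
  where
  *ₚ-isCommutativeMonoidʳ : IsCommutativeMonoidʳ _*ₚ_ (qpow 0)
  *ₚ-isCommutativeMonoidʳ = record
    { isSemigroup = record { isMagma = record { isEquivalence = ≋-isEquivalence ; ∙-cong = *ₚ-cong } ; assoc = *ₚ-assoc }
    ; identityʳ   = λ p → ≋-trans (*ₚ-comm p (qpow 0)) (*ₚ-identityˡ p)
    ; comm        = *ₚ-comm
    }

open NaturalCoefficientSolver polyCommutativeSemiring using (solve; _:+_; _:*_; _:=_; con)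

*ₚ-distribˡ : ∀ s p r → s *ₚ (p +ₚ r) ≋ s *ₚ p +ₚ s *ₚ r
*ₚ-distribˡ = solve 3 (λ s p r → s :* (p :+ r) := s :* p :+ s :* r) ≋-refl

qpow-+ : ∀ a b → qpow a *ₚ qpow b ≋ qpow (a + b)
qpow-+ zero    b = *ₚ-identityˡ (qpow b)
qpow-+ (suc a) b = ≋-trans (0∷-*ₚ (qpow a) (qpow b)) (∷-cong refl (qpow-+ a b))

sumₚ-++ : ∀ xs ys → sumₚ (xs ++ ys) ≋ sumₚ xs +ₚ sumₚ ys
sumₚ-++ []       ys = ≋-refl
sumₚ-++ (x ∷ xs) ys = ≋-trans (+ₚ-cong ≋-refl (sumₚ-++ xs ys)) (≋-sym (+ₚ-assoc x _ _))

sumₚ-map-cong : ∀ {A : Set} {f g : A → Poly} xs → (∀ x → f x ≋ g x) → sumₚ (map f xs) ≋ sumₚ (map g xs)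
sumₚ-map-cong []       f≋g = ≋-refl
sumₚ-map-cong (x ∷ xs) f≋g = +ₚ-cong (f≋g x) (sumₚ-map-cong xs f≋g)

sumₚ-map-congᴬ : ∀ {A : Set} {P : A → Set} {f g : A → Poly} {xs} → All P xs → (∀ x → P x → f x ≋ g x) →
  sumₚ (map f xs) ≋ sumₚ (map g xs)
sumₚ-map-congᴬ []         f≋g = ≋-refl
sumₚ-map-congᴬ (px ∷ pxs) f≋g = +ₚ-cong (f≋g _ px) (sumₚ-map-congᴬ pxs f≋g)

sumₚ-map-zero : ∀ {A : Set} {f : A → Poly} xs → (∀ x → f x ≋ []) → sumₚ (map f xs) ≋ []
sumₚ-map-zero []       f≋0 = ≋-refl
sumₚ-map-zero (x ∷ xs) f≋0 = +ₚ-cong (f≋0 x) (sumₚ-map-zero xs f≋0)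

sumₚ-map-+ₚ : ∀ {A : Set} (f g : A → Poly) xs →
  sumₚ (map (λ x → f x +ₚ g x) xs) ≋ sumₚ (map f xs) +ₚ sumₚ (map g xs)
sumₚ-map-+ₚ f g []       = ≋-refl
sumₚ-map-+ₚ f g (x ∷ xs) = ≋-trans (+ₚ-cong ≋-refl (sumₚ-map-+ₚ f g xs)) (+ₚ-interchange (f x) (g x) _ _)

*ₚ-sumₚ-map : ∀ {A : Set} p (f : A → Poly) xs → p *ₚ sumₚ (map f xs) ≋ sumₚ (map (λ x → p *ₚ f x) xs)
*ₚ-sumₚ-map p f []       = *ₚ-zeroʳ p
*ₚ-sumₚ-map p f (x ∷ xs) = ≋-trans (*ₚ-distribˡ p (f x) _) (+ₚ-cong ≋-refl (*ₚ-sumₚ-map p f xs))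

sumₚ-map-*ₚ : ∀ {A : Set} p (f : A → Poly) xs → sumₚ (map f xs) *ₚ p ≋ sumₚ (map (λ x → f x *ₚ p) xs)
sumₚ-map-*ₚ p f []       = ≋-refl
sumₚ-map-*ₚ p f (x ∷ xs) = ≋-trans (*ₚ-distribʳ p (f x) _) (+ₚ-cong ≋-refl (sumₚ-map-*ₚ p f xs))

sumₚ-map-∘ : ∀ {A B : Set} (f : B → Poly) (g : A → B) xs → sumₚ (map f (map g xs)) ≋ sumₚ (map (f ∘ g) xs)
sumₚ-map-∘ f g xs = ≡⇒≋ (cong sumₚ (sym (map-∘ xs)))

sumₚ-map-sum-comm : ∀ {A B : Set} (f : A → B → Poly) xs ys →
  sumₚ (map (λ a → sumₚ (map (f a) ys)) xs) ≋ sumₚ (map (λ b → sumₚ (map (λ a → f a b) xs)) ys)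
sumₚ-map-sum-comm f []       ys = ≋-sym (sumₚ-map-zero ys λ _ → ≋-refl)
sumₚ-map-sum-comm f (x ∷ xs) ys = ≋-trans (+ₚ-cong ≋-refl (sumₚ-map-sum-comm f xs ys))
  (≋-sym (sumₚ-map-+ₚ (f x) (λ b → sumₚ (map (λ a → f a b) xs)) ys))

sumₚ-map-↭ : ∀ {A : Set} (f : A → Poly) {xs ys} → xs ↭ ys → sumₚ (map f xs) ≋ sumₚ (map f ys)
sumₚ-map-↭ f ↭.refl          = ≋-refl
sumₚ-map-↭ f (↭.prep x xs↭ys) = +ₚ-cong ≋-refl (sumₚ-map-↭ f xs↭ys)
sumₚ-map-↭ f (↭.swap x y xs↭ys) =
  ≋-trans (+ₚ-cong {f x} ≋-refl (+ₚ-cong {f y} ≋-refl (sumₚ-map-↭ f xs↭ys))) (+ₚ-exchange (f x) (f y) _)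
sumₚ-map-↭ f (↭.trans xs↭ys ys↭zs) = ≋-trans (sumₚ-map-↭ f xs↭ys) (sumₚ-map-↭ f ys↭zs)

sumₚ-map-filter : ∀ {A : Set} {P : Pred A 0ℓ} (P? : Decidable P) (f : A → Poly) xs →
  sumₚ (map f (filter P? xs)) ≋ sumₚ (map (λ x → if does (P? x) then f x else []) xs)
sumₚ-map-filter P? f []       = ≋-refl
sumₚ-map-filter P? f (x ∷ xs) with does (P? x)
... | true  = +ₚ-cong ≋-refl (sumₚ-map-filter P? f xs)
... | false = sumₚ-map-filter P? f xs

qint-suc : ∀ n → qint (suc n) ≋ qpow n +ₚ qint n
qint-suc n = begin
  sumₚ (map qpow (upTo (suc n)))           ≡⟨ cong (sumₚ ∘ map qpow) (sym (upTo-∷ʳ n)) ⟩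
  sumₚ (map qpow (upTo n ++ n ∷ []))       ≡⟨ cong sumₚ (map-++ qpow (upTo n) (n ∷ [])) ⟩
  sumₚ (map qpow (upTo n) ++ qpow n ∷ [])  ≈⟨ sumₚ-++ (map qpow (upTo n)) (qpow n ∷ []) ⟩
  qint n +ₚ (qpow n +ₚ [])                 ≈⟨ +ₚ-cong ≋-refl (+ₚ-identityʳ (qpow n)) ⟩
  qint n +ₚ qpow n                         ≈⟨ +ₚ-comm (qint n) (qpow n) ⟩
  qpow n +ₚ qint n                         ∎
  where open ≋-Reasoning

qint-suc-shifted : ∀ n → qint (suc n) ≋ qpow 0 +ₚ qpow 1 *ₚ qint n
qint-suc-shifted n = +ₚ-cong ≋-refl (begin
  sumₚ (map qpow (applyUpTo suc n))             ≡⟨ cong (sumₚ ∘ map qpow) (map-applyUpTo id suc n) ⟨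
  sumₚ (map qpow (map suc (upTo n)))            ≈⟨ sumₚ-map-∘ qpow suc (upTo n) ⟩
  sumₚ (map (qpow ∘ suc) (upTo n))              ≈⟨ sumₚ-map-cong (upTo n) (λ j → ≋-sym (qpow-+ 1 j)) ⟩
  sumₚ (map (λ j → qpow 1 *ₚ qpow j) (upTo n))  ≈⟨ *ₚ-sumₚ-map (qpow 1) qpow (upTo n) ⟨
  qpow 1 *ₚ qint n                              ∎)
  where open ≋-Reasoning

does-≟true : ∀ b → does (b ≟B true) ≡ b
does-≟true true  = refl
does-≟true false = refl

≡ᵇ-sym : ∀ m n → (m ≡ᵇ n) ≡ (n ≡ᵇ m)
≡ᵇ-sym zero    zero    = refl
≡ᵇ-sym zero    (suc n) = refl
≡ᵇ-sym (suc m) zero    = refl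
≡ᵇ-sym (suc m) (suc n) = ≡ᵇ-sym m n

≡ᵇ-refl : ∀ m → (m ≡ᵇ m) ≡ true
≡ᵇ-refl zero    = refl
≡ᵇ-refl (suc m) = ≡ᵇ-refl m

≡ᵇ-true⇒≡ : ∀ {m n} → (m ≡ᵇ n) ≡ true → m ≡ n
≡ᵇ-true⇒≡ {m} {n} m≡ᵇn = ≡ᵇ⇒≡ m n (subst T (sym m≡ᵇn) _)

<ᵇ-irrefl : ∀ m → (m <ᵇ m) ≡ false
<ᵇ-irrefl zero    = refl
<ᵇ-irrefl (suc m) = <ᵇ-irrefl m

<ᵇ⇒≢ᵇ : ∀ m n → (m <ᵇ n) ≡ true → (m ≡ᵇ n) ≡ false
<ᵇ⇒≢ᵇ zero    (suc n) _   = refl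
<ᵇ⇒≢ᵇ (suc m) (suc n) m<n = <ᵇ⇒≢ᵇ m n m<n

<ᵇ⇒≢ᵇ˘ : ∀ m n → (m <ᵇ n) ≡ true → (n ≡ᵇ m) ≡ false
<ᵇ⇒≢ᵇ˘ m n m<n = trans (≡ᵇ-sym n m) (<ᵇ⇒≢ᵇ m n m<n)

<ᵇ-asym : ∀ m n → (m <ᵇ n) ≡ true → (n <ᵇ m) ≡ false
<ᵇ-asym zero    (suc n) _   = refl
<ᵇ-asym (suc m) (suc n) m<n = <ᵇ-asym m n m<n

<⇒<ᵇ≡true : ∀ {m n} → m < n → (m <ᵇ n) ≡ true
<⇒<ᵇ≡true {zero}  {suc n} _         = refl
<⇒<ᵇ≡true {suc m} {suc n} (s≤s m<n) = <⇒<ᵇ≡true m<n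

trichotomyᵇ : ∀ m n → not (n ≡ᵇ m) ∧ not (n <ᵇ m) ≡ (m <ᵇ n)
trichotomyᵇ zero    zero    = refl
trichotomyᵇ zero    (suc n) = refl
trichotomyᵇ (suc m) zero    = refl
trichotomyᵇ (suc m) (suc n) = trichotomyᵇ m n

not-∨ : ∀ a b → not (a ∨ b) ≡ not a ∧ not b
not-∨ true  b = refl
not-∨ false b = refl

count : ∀ {A : Set} → (A → Bool) → List A → ℕ
count f []       = 0
count f (x ∷ xs) = if f x then suc (count f xs) else count f xs

length-filter≡count : ∀ {A : Set} (f : A → Bool) xs → length (filter (λ x → f x ≟B true) xs) ≡ count f xs
length-filter≡count f []       = refl
length-filter≡count f (x ∷ xs) with f x
... | true  = cong suc (length-filter≡count f xs)
... | false = length-filter≡count f xs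

count-true : ∀ {A : Set} (xs : List A) → count (λ _ → true) xs ≡ length xs
count-true []       = refl
count-true (x ∷ xs) = cong suc (count-true xs)

count-skip : ∀ {A : Set} (f : A → Bool) {x} xs → f x ≡ false → count f (x ∷ xs) ≡ count f xs
count-skip f xs fx rewrite fx = refl

count-take : ∀ {A : Set} (f : A → Bool) {x} xs → f x ≡ true → count f (x ∷ xs) ≡ suc (count f xs)
count-take f xs fx rewrite fx = refl

count-++ : ∀ {A : Set} (f : A → Bool) xs ys → count f (xs ++ ys) ≡ count f xs + count f ys
count-++ f []       ys = refl
count-++ f (x ∷ xs) ys with f x
... | true  = cong suc (count-++ f xs ys)
... | false = count-++ f xs ys

count-map : ∀ {A B : Set} (f : B → Bool) (g : A → B) xs → count f (map g xs) ≡ count (f ∘ g) xs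
count-map f g []       = refl
count-map f g (x ∷ xs) with f (g x)
... | true  = cong suc (count-map f g xs)
... | false = count-map f g xs

count-congᴬ : ∀ {A : Set} {P : A → Set} {f g : A → Bool} {xs : List A} → All P xs → (∀ x → P x → f x ≡ g x) →
  count f xs ≡ count g xs
count-congᴬ []         f≡g = refl
count-congᴬ {g = g} {x ∷ _} (px ∷ pxs) f≡g rewrite f≡g x px with g x
... | true  = cong suc (count-congᴬ pxs f≡g)
... | false = count-congᴬ pxs f≡g

count-cong : ∀ {A : Set} {f g : A → Bool} xs → (∀ x → f x ≡ g x) → count f xs ≡ count g xs
count-cong []       f≡g = refl
count-cong {g = g} (x ∷ xs) f≡g rewrite f≡g x with g x
... | true  = cong suc (count-cong xs f≡g)
... | false = count-cong xs f≡g

count-↭ : ∀ {A : Set} (f : A → Bool) {xs ys} → xs ↭ ys → count f xs ≡ count f ys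
count-↭ f ↭.refl = refl
count-↭ f (↭.prep x xs↭ys) rewrite count-↭ f xs↭ys = refl
count-↭ f (↭.swap x y xs↭ys) rewrite count-↭ f xs↭ys with f x | f y
... | true  | true  = refl
... | true  | false = refl
... | false | true  = refl
... | false | false = refl
count-↭ f (↭.trans xs↭ys ys↭zs) = trans (count-↭ f xs↭ys) (count-↭ f ys↭zs)

anyB-map : ∀ {A B : Set} (f : B → Bool) (g : A → B) xs → anyB f (map g xs) ≡ anyB (f ∘ g) xs
anyB-map f g []       = refl
anyB-map f g (x ∷ xs) = cong (f (g x) ∨_) (anyB-map f g xs)

anyB-cong : ∀ {A : Set} {f g : A → Bool} xs → (∀ x → f x ≡ g x) → anyB f xs ≡ anyB g xs
anyB-cong []       f≡g = refl
anyB-cong (x ∷ xs) f≡g = cong₂ _∨_ (f≡g x) (anyB-cong xs f≡g)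

anyB-congᴬ : ∀ {A : Set} {P : A → Set} {f g : A → Bool} {xs : List A} → All P xs → (∀ x → P x → f x ≡ g x) →
  anyB f xs ≡ anyB g xs
anyB-congᴬ []         f≡g = refl
anyB-congᴬ (px ∷ pxs) f≡g = cong₂ _∨_ (f≡g _ px) (anyB-congᴬ pxs f≡g)

anyB-false : ∀ {A : Set} {P : A → Set} (f : A → Bool) {xs : List A} → All P xs → (∀ x → P x → f x ≡ false) →
  anyB f xs ≡ false
anyB-false f []         f≡false = refl
anyB-false f (px ∷ pxs) f≡false rewrite f≡false _ px = anyB-false f pxs f≡false

anyB-mono : ∀ {A : Set} (f g : A → Bool) xs → (∀ x → g x ≡ true → f x ≡ true) → anyB f xs ≡ false → anyB g xs ≡ false
anyB-mono f g []       g⇒f _ = refl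
anyB-mono f g (x ∷ xs) g⇒f none with f x in fx
anyB-mono f g (x ∷ xs) g⇒f () | true
... | false with g x in gx
... | true  with () <- trans (sym fx) (g⇒f x gx)
... | false = anyB-mono f g xs g⇒f none

anyB-↭ : ∀ {A : Set} (f : A → Bool) {xs ys} → xs ↭ ys → anyB f xs ≡ anyB f ys
anyB-↭ f ↭.refl               = refl
anyB-↭ f (↭.prep x xs↭ys)     = cong (f x ∨_) (anyB-↭ f xs↭ys)
anyB-↭ f (↭.swap x y xs↭ys)   = trans (cong (λ b → f x ∨ (f y ∨ b)) (anyB-↭ f xs↭ys)) (∨-exchange (f x) (f y) _)
  where
  ∨-exchange : ∀ a b c → a ∨ (b ∨ c) ≡ b ∨ (a ∨ c)
  ∨-exchange true  b c = sym (∨-zeroʳ b)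
  ∨-exchange false b c = refl
anyB-↭ f (↭.trans xs↭ys ys↭zs) = trans (anyB-↭ f xs↭ys) (anyB-↭ f ys↭zs)

sumSublists : ∀ {A : Set} → (List A → Poly) → List A → Poly
sumSublists g C = sumₚ (map g (sublists C))

sumSublists-∷ : ∀ {A : Set} (g : List A → Poly) x C →
  sumSublists g (x ∷ C) ≋ sumSublists (g ∘ (x ∷_)) C +ₚ sumSublists g C
sumSublists-∷ g x C = begin
  sumₚ (map g (map (x ∷_) (sublists C) ++ sublists C))                 ≡⟨ cong sumₚ (map-++ g (map (x ∷_) (sublists C)) (sublists C)) ⟩
  sumₚ (map g (map (x ∷_) (sublists C)) ++ map g (sublists C))         ≈⟨ sumₚ-++ (map g (map (x ∷_) (sublists C))) _ ⟩
  sumₚ (map g (map (x ∷_) (sublists C))) +ₚ sumSublists g C            ≈⟨ +ₚ-cong (sumₚ-map-∘ g (x ∷_) (sublists C)) ≋-refl ⟩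
  sumSublists (g ∘ (x ∷_)) C +ₚ sumSublists g C                        ∎
  where open ≋-Reasoning

sumSublists-++ : ∀ {A : Set} (g : List A → Poly) C D →
  sumSublists g (C ++ D) ≋ sumSublists (λ a → sumSublists (λ b → g (a ++ b)) D) C
sumSublists-++ g []      D = ≋-sym (+ₚ-identityʳ _)
sumSublists-++ g (x ∷ C) D = ≋-trans (sumSublists-∷ g x (C ++ D))
  (≋-trans (+ₚ-cong (sumSublists-++ (g ∘ (x ∷_)) C D) (sumSublists-++ g C D))
           (≋-sym (sumSublists-∷ (λ a → sumSublists (λ b → g (a ++ b)) D) x C)))

sumSublists-congᴬ : ∀ {A : Set} {P : A → Set} {g h : List A → Poly} {C} → All P C →
  (∀ p → All P p → g p ≋ h p) → sumSublists g C ≋ sumSublists h C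
sumSublists-congᴬ {g = g} {h} {[]}    []       g≋h = +ₚ-cong (g≋h [] []) ≋-refl
sumSublists-congᴬ {g = g} {h} {x ∷ C} (px ∷ pC) g≋h = ≋-trans (sumSublists-∷ g x C)
  (≋-trans (+ₚ-cong (sumSublists-congᴬ pC λ p pp → g≋h (x ∷ p) (px ∷ pp)) (sumSublists-congᴬ pC g≋h))
           (≋-sym (sumSublists-∷ h x C)))

sumSublists-cong : ∀ {A : Set} {g h : List A → Poly} C → (∀ p → g p ≋ h p) → sumSublists g C ≋ sumSublists h C
sumSublists-cong C g≋h = sumₚ-map-cong (sublists C) g≋h

sumSublists-zero : ∀ {A : Set} (C : List A) → sumSublists (λ _ → []) C ≋ []
sumSublists-zero C = sumₚ-map-zero (sublists C) (λ _ → ≋-refl)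

sumSublists-map : ∀ {A B : Set} (g : List B → Poly) (f : A → B) C →
  sumSublists g (map f C) ≋ sumSublists (g ∘ map f) C
sumSublists-map g f []      = ≋-refl
sumSublists-map g f (x ∷ C) = ≋-trans (sumSublists-∷ g (f x) (map f C))
  (≋-trans (+ₚ-cong (sumSublists-map (g ∘ (f x ∷_)) f C) (sumSublists-map g f C))
           (≋-sym (sumSublists-∷ (g ∘ map f) x C)))

PermInvariant : ∀ {A : Set} → (List A → Poly) → Set
PermInvariant g = ∀ {p p′} → p ↭ p′ → g p ≋ g p′

sumSublists-↭ : ∀ {A : Set} (g : List A → Poly) → PermInvariant g → ∀ {C C′} → C ↭ C′ →
  sumSublists g C ≋ sumSublists g C′
sumSublists-↭ g g-inv ↭.refl = ≋-refl
sumSublists-↭ g g-inv {x ∷ C} {.x ∷ C′} (↭.prep x C↭C′) = begin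
  sumSublists g (x ∷ C)                              ≈⟨ sumSublists-∷ g x C ⟩
  sumSublists (g ∘ (x ∷_)) C +ₚ sumSublists g C      ≈⟨ +ₚ-cong (sumSublists-↭ (g ∘ (x ∷_)) (g-inv ∘ ↭.prep x) C↭C′)
                                                                (sumSublists-↭ g g-inv C↭C′) ⟩
  sumSublists (g ∘ (x ∷_)) C′ +ₚ sumSublists g C′    ≈⟨ sumSublists-∷ g x C′ ⟨
  sumSublists g (x ∷ C′)                             ∎
  where open ≋-Reasoning
sumSublists-↭ g g-inv {x ∷ y ∷ C} {.y ∷ .x ∷ C′} (↭.swap x y C↭C′) = begin
  sumSublists g (x ∷ y ∷ C)
    ≈⟨ expand x y C ⟩
  (sumSublists (g ∘ (x ∷_) ∘ (y ∷_)) C +ₚ sumSublists (g ∘ (x ∷_)) C) +ₚ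
  (sumSublists (g ∘ (y ∷_)) C +ₚ sumSublists g C)
    ≈⟨ +ₚ-interchange (sumSublists (g ∘ (x ∷_) ∘ (y ∷_)) C) (sumSublists (g ∘ (x ∷_)) C) _ _ ⟩
  (sumSublists (g ∘ (x ∷_) ∘ (y ∷_)) C +ₚ sumSublists (g ∘ (y ∷_)) C) +ₚ
  (sumSublists (g ∘ (x ∷_)) C +ₚ sumSublists g C)
    ≈⟨ +ₚ-cong (+ₚ-cong (≋-trans (sumSublists-cong C λ _ → g-inv (↭.swap x y ↭.refl))
                                 (sumSublists-↭ (g ∘ (y ∷_) ∘ (x ∷_)) (g-inv ∘ ↭.prep y ∘ ↭.prep x) C↭C′))
                        (sumSublists-↭ (g ∘ (y ∷_)) (g-inv ∘ ↭.prep y) C↭C′))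
               (+ₚ-cong (sumSublists-↭ (g ∘ (x ∷_)) (g-inv ∘ ↭.prep x) C↭C′) (sumSublists-↭ g g-inv C↭C′)) ⟩
  (sumSublists (g ∘ (y ∷_) ∘ (x ∷_)) C′ +ₚ sumSublists (g ∘ (y ∷_)) C′) +ₚ
  (sumSublists (g ∘ (x ∷_)) C′ +ₚ sumSublists g C′)
    ≈⟨ expand y x C′ ⟨
  sumSublists g (y ∷ x ∷ C′)
    ∎
  where
  open ≋-Reasoning
  expand : ∀ a b D → sumSublists g (a ∷ b ∷ D) ≋
    (sumSublists (g ∘ (a ∷_) ∘ (b ∷_)) D +ₚ sumSublists (g ∘ (a ∷_)) D) +ₚ (sumSublists (g ∘ (b ∷_)) D +ₚ sumSublists g D)
  expand a b D = ≋-trans (sumSublists-∷ g a (b ∷ D)) (+ₚ-cong (sumSublists-∷ (g ∘ (a ∷_)) b D) (sumSublists-∷ g b D))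
sumSublists-↭ g g-inv (↭.trans C↭C′ C′↭C″) = ≋-trans (sumSublists-↭ g g-inv C↭C′) (sumSublists-↭ g g-inv C′↭C″)

Rb : ℕ → List Cell → Poly
Rb k C = sumₚ (map (λ p → qpow (length (filter (λ c → counted p c ≟B true) C)))
  (filter (λ p → length p ≟ k) (filter (λ p → nonAttacking p ≟B true) (sublists C))))

Rb₋₁ : ℕ → List Cell → Poly
Rb₋₁ zero    C = []
Rb₋₁ (suc k) C = Rb k C

invOn : List Cell → List Cell → ℕ
invOn C p = count (counted p) C

weight : ℕ → List Cell → List Cell → Poly
weight k C p = if nonAttacking p then (if length p ≡ᵇ k then qpow (invOn C p) else []) else []

weight₋₁ : ℕ → List Cell → List Cell → Poly
weight₋₁ zero    C p = []
weight₋₁ (suc k) C p = weight k C p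

Rb≋sumSublists : ∀ k C → Rb k C ≋ sumSublists (weight k C) C
Rb≋sumSublists k C = ≋-trans (sumₚ-map-filter (λ p → length p ≟ k) term (filter (λ p → nonAttacking p ≟B true) (sublists C)))
  (≋-trans (sumₚ-map-filter (λ p → nonAttacking p ≟B true) (λ p → if does (length p ≟ k) then term p else []) (sublists C))
           (sumSublists-cong C λ p → ≡⇒≋ (term≡weight p)))
  where
  term : List Cell → Poly
  term p = qpow (length (filter (λ c → counted p c ≟B true) C))
  term≡weight : ∀ p → (if does (nonAttacking p ≟B true) then (if does (length p ≟ k) then term p else []) else [])
                      ≡ weight k C p
  term≡weight p rewrite does-≟true (nonAttacking p) | length-filter≡count (counted p) C = refl

Rb₋₁≋sumSublists : ∀ k C → Rb₋₁ k C ≋ sumSublists (weight₋₁ k C) C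
Rb₋₁≋sumSublists zero    C = ≋-sym (sumSublists-zero C)
Rb₋₁≋sumSublists (suc k) C = Rb≋sumSublists k C

attacks-sym : ∀ x y → attacks x y ≡ attacks y x
attacks-sym x y = cong₂ _∨_ (≡ᵇ-sym (proj₁ x) (proj₁ y)) (≡ᵇ-sym (proj₂ x) (proj₂ y))

nonAttacking-↭ : ∀ {p p′} → p ↭ p′ → nonAttacking p ≡ nonAttacking p′
nonAttacking-↭ ↭.refl = refl
nonAttacking-↭ (↭.prep x p↭p′) = cong₂ _∧_ (cong not (anyB-↭ (attacks x) p↭p′)) (nonAttacking-↭ p↭p′)
nonAttacking-↭ {x ∷ y ∷ p} {.y ∷ .x ∷ p′} (↭.swap x y p↭p′)
  rewrite anyB-↭ (attacks x) p↭p′ | anyB-↭ (attacks y) p↭p′ | nonAttacking-↭ p↭p′ | attacks-sym y x =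
  exchange (attacks x y) (anyB (attacks x) p′) (anyB (attacks y) p′) (nonAttacking p′)
  where
  exchange : ∀ a b c d → not (a ∨ b) ∧ (not c ∧ d) ≡ not (a ∨ c) ∧ (not b ∧ d)
  exchange true  b     c     d = refl
  exchange false true  true  d = refl
  exchange false true  false d = refl
  exchange false false true  d = refl
  exchange false false false d = refl
nonAttacking-↭ (↭.trans p↭p′ p′↭p″) = trans (nonAttacking-↭ p↭p′) (nonAttacking-↭ p′↭p″)

counted-↭ : ∀ {p p′} → p ↭ p′ → ∀ c → counted p c ≡ counted p′ c
counted-↭ p↭p′ c =
  cong₂ _∧_ (cong not (anyB-↭ _ p↭p′)) (cong₂ _∧_ (cong not (anyB-↭ _ p↭p′)) (cong not (anyB-↭ _ p↭p′)))

weight-↭ : ∀ k C → PermInvariant (weight k C)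
weight-↭ k C {p} {p′} p↭p′
  rewrite nonAttacking-↭ p↭p′ | ↭-length p↭p′ | count-cong {f = counted p} C (counted-↭ p↭p′) = ≋-refl

Rb-↭ : ∀ k {C C′} → C ↭ C′ → Rb k C ≋ Rb k C′
Rb-↭ k {C} {C′} C↭C′ = begin
  Rb k C                            ≈⟨ Rb≋sumSublists k C ⟩
  sumSublists (weight k C) C        ≈⟨ sumSublists-↭ (weight k C) (weight-↭ k C) C↭C′ ⟩
  sumSublists (weight k C) C′       ≈⟨ sumSublists-cong C′ (λ p → ≡⇒≋ (cong (λ n → weight′ n p)
                                                                              (count-↭ (counted p) C↭C′))) ⟩
  sumSublists (weight k C′) C′      ≈⟨ Rb≋sumSublists k C′ ⟨
  Rb k C′                           ∎
  where
  open ≋-Reasoning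
  weight′ : ℕ → List Cell → Poly
  weight′ n p = if nonAttacking p then (if length p ≡ᵇ k then qpow n else []) else []

module Relabel (f : Cell → Cell)
  (attacks-f : ∀ x y → attacks (f x) (f y) ≡ attacks x y)
  (counted-f : ∀ p c → counted (map f p) (f c) ≡ counted p c) where

  nonAttacking-map : ∀ p → nonAttacking (map f p) ≡ nonAttacking p
  nonAttacking-map []      = refl
  nonAttacking-map (x ∷ p) =
    cong₂ _∧_ (cong not (trans (anyB-map (attacks (f x)) f p) (anyB-cong p (attacks-f x)))) (nonAttacking-map p)

  weight-map : ∀ k C p → weight k (map f C) (map f p) ≡ weight k C p
  weight-map k C p rewrite nonAttacking-map p | length-map f p | count-map (counted (map f p)) f C
    | count-cong {f = counted (map f p) ∘ f} C (counted-f p) = refl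

  Rb-map : ∀ k C → Rb k (map f C) ≋ Rb k C
  Rb-map k C = begin
    Rb k (map f C)                                  ≈⟨ Rb≋sumSublists k (map f C) ⟩
    sumSublists (weight k (map f C)) (map f C)      ≈⟨ sumSublists-map (weight k (map f C)) f C ⟩
    sumSublists (weight k (map f C) ∘ map f) C      ≈⟨ sumSublists-cong C (λ p → ≡⇒≋ (weight-map k C p)) ⟩
    sumSublists (weight k C) C                      ≈⟨ Rb≋sumSublists k C ⟨
    Rb k C                                          ∎
    where open ≋-Reasoning

  Rb₋₁-map : ∀ k C → Rb₋₁ k (map f C) ≋ Rb₋₁ k C
  Rb₋₁-map zero    C = ≋-refl
  Rb₋₁-map (suc k) C = Rb-map k C

-- Adding a full row to a board

weight-scaled : ∀ k C C′ p e → (nonAttacking p ≡ true → length p ≡ k → invOn C′ p ≡ e + invOn C p) →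
  weight k C′ p ≋ qpow e *ₚ weight k C p
weight-scaled k C C′ p e inv≡ with nonAttacking p | length p ≡ᵇ k in ℓ≡ᵇk
... | false | _     = ≋-sym (*ₚ-zeroʳ (qpow e))
... | true  | false = ≋-sym (*ₚ-zeroʳ (qpow e))
... | true  | true  = ≋-trans (≡⇒≋ (cong qpow (inv≡ refl (≡ᵇ-true⇒≡ ℓ≡ᵇk)))) (≋-sym (qpow-+ e _))

weight-∷-scaled : ∀ k C C′ x p g e → not (anyB (attacks x) p) ≡ g →
  (nonAttacking p ≡ true → length p ≡ k → invOn C′ (x ∷ p) ≡ e + invOn C p) →
  weight (suc k) C′ (x ∷ p) ≋ (if g then qpow e else []) *ₚ weight k C p
weight-∷-scaled k C C′ x p g e x-free inv≡ rewrite x-free with g | nonAttacking p | length p ≡ᵇ k in ℓ≡ᵇk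
... | false | _     | _     = ≋-refl
... | true  | false | _     = ≋-sym (*ₚ-zeroʳ (qpow e))
... | true  | true  | false = ≋-sym (*ₚ-zeroʳ (qpow e))
... | true  | true  | true  = ≋-trans (≡⇒≋ (cong qpow (inv≡ refl (≡ᵇ-true⇒≡ ℓ≡ᵇk)))) (≋-sym (qpow-+ e _))

sumₚ-qpow-countRight≋qint : ∀ (F : ℕ → Bool) cols → AllPairs _<_ cols →
  sumₚ (map (λ c → if F c then qpow (count (λ c′ → (c <ᵇ c′) ∧ F c′) cols) else []) cols) ≋ qint (count F cols)
sumₚ-qpow-countRight≋qint F []       []             = ≋-refl
sumₚ-qpow-countRight≋qint F (c ∷ cs) (c<cs ∷ cs↑) = begin
  term (c ∷ cs) c +ₚ sumₚ (map (term (c ∷ cs)) cs)              ≈⟨ +ₚ-cong (≡⇒≋ head≡) (sumₚ-map-congᴬ c<cs tail≋) ⟩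
  (if F c then qpow (count F cs) else []) +ₚ sumₚ (map (term cs) cs)
                                                                ≈⟨ +ₚ-cong ≋-refl (sumₚ-qpow-countRight≋qint F cs cs↑) ⟩
  (if F c then qpow (count F cs) else []) +ₚ qint (count F cs)  ≈⟨ add-top ⟩
  qint (count F (c ∷ cs))                                       ∎
  where
  open ≋-Reasoning
  term : List ℕ → ℕ → Poly
  term ds d = if F d then qpow (count (λ d′ → (d <ᵇ d′) ∧ F d′) ds) else []
  head≡ : term (c ∷ cs) c ≡ (if F c then qpow (count F cs) else [])
  head≡ = cong (λ n → if F c then qpow n else [])
    (trans (count-skip _ cs (cong (_∧ F c) (<ᵇ-irrefl c))) (count-congᴬ c<cs λ d c<d → cong (_∧ F d) (<⇒<ᵇ≡true c<d)))
  tail≋ : ∀ d → c < d → term (c ∷ cs) d ≋ term cs d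
  tail≋ d c<d = ≡⇒≋ (cong (λ n → if F d then qpow n else [])
    (count-skip _ cs (cong (_∧ F c) (<ᵇ-asym c d (<⇒<ᵇ≡true c<d)))))
  add-top : (if F c then qpow (count F cs) else []) +ₚ qint (count F cs) ≋ qint (count F (c ∷ cs))
  add-top with F c
  ... | true  = ≋-sym (qint-suc (count F cs))
  ... | false = ≋-refl

count-remove : ∀ (G : ℕ → Bool) {d : ℕ} cols → AllPairs _<_ cols → d ∈ cols → G d ≡ true →
  suc (count (λ c → not (d ≡ᵇ c) ∧ G c) cols) ≡ count G cols
count-remove G (c ∷ cs) (c<cs ∷ cs↑) (here refl) Gc = begin
  suc (count (λ c′ → not (c ≡ᵇ c′) ∧ G c′) (c ∷ cs)) ≡⟨ cong suc (count-skip _ cs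
                                                           (cong (λ b → not b ∧ G c) (≡ᵇ-refl c))) ⟩
  suc (count (λ c′ → not (c ≡ᵇ c′) ∧ G c′) cs)       ≡⟨ cong suc (count-congᴬ c<cs λ c′ c<c′ →
                                                           cong (λ b → not b ∧ G c′) (<ᵇ⇒≢ᵇ c c′ (<⇒<ᵇ≡true c<c′))) ⟩
  suc (count G cs)                                   ≡⟨ count-take G cs Gc ⟨
  count G (c ∷ cs)                                   ∎
  where open ≡-Reasoning
count-remove G {d} (c ∷ cs) (c<cs ∷ cs↑) (there d∈cs) Gd
  rewrite <ᵇ⇒≢ᵇ˘ c d (<⇒<ᵇ≡true (All.lookup c<cs d∈cs)) with G c
... | true  = cong suc (count-remove G cs cs↑ d∈cs Gd)
... | false = count-remove G cs cs↑ d∈cs Gd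

columnFree : List Cell → ℕ → Bool
columnFree b c = not (anyB (λ y → proj₂ y ≡ᵇ c) b)

count-columnFree+length : ∀ b cols → AllPairs _<_ cols → nonAttacking b ≡ true → All (λ y → proj₂ y ∈ cols) b →
  count (columnFree b) cols + length b ≡ length cols
count-columnFree+length []      cols cols↑ _  []          = trans (+-identityʳ _) (count-true cols)
count-columnFree+length (y ∷ b) cols cols↑ na (y∈ ∷ b∈) with anyB (attacks y) b in y-attacks | nonAttacking b in b-na
-- In the omitted cases na has become false ≡ true.
... | false | true = begin
  count (columnFree (y ∷ b)) cols + suc (length b)                          ≡⟨ +-suc _ (length b) ⟩
  suc (count (columnFree (y ∷ b)) cols) + length b                          ≡⟨ cong (λ n → suc n + length b)
                                                                                (count-cong cols λ c → not-∨ (proj₂ y ≡ᵇ c) _) ⟩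
  suc (count (λ c → not (proj₂ y ≡ᵇ c) ∧ columnFree b c) cols) + length b  ≡⟨ cong (_+ length b)
                                                                                (count-remove (columnFree b) cols cols↑ y∈ y-column-free) ⟩
  count (columnFree b) cols + length b                                      ≡⟨ count-columnFree+length b cols cols↑ b-na b∈ ⟩
  length cols                                                               ∎
  where
  open ≡-Reasoning
  y-column-free : columnFree b (proj₂ y) ≡ true
  y-column-free = cong not (anyB-mono (attacks y) (λ z → proj₂ z ≡ᵇ proj₂ y) b
    (λ z same-column → trans (cong ((proj₁ y ≡ᵇ proj₁ z) ∨_) (trans (≡ᵇ-sym (proj₂ y) (proj₂ z)) same-column)) (∨-zeroʳ _))
    y-attacks)

sumSublists-atMostOne : ∀ {A : Set} {P : A → Set} (G : List A → Poly) {L} → All P L →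
  (∀ x y rest → P x → P y → G (x ∷ y ∷ rest) ≋ []) → sumSublists G L ≋ G [] +ₚ sumₚ (map (λ x → G (x ∷ [])) L)
sumSublists-atMostOne G []                 G-vanishes = ≋-refl
sumSublists-atMostOne {P = P} G {x ∷ L} (px ∷ pL) G-vanishes = begin
  sumSublists G (x ∷ L)
    ≈⟨ sumSublists-∷ G x L ⟩
  sumSublists (G ∘ (x ∷_)) L +ₚ sumSublists G L
    ≈⟨ +ₚ-cong (onlyHead (G ∘ (x ∷_)) pL λ y rest py → G-vanishes x y rest px py) (sumSublists-atMostOne G pL G-vanishes) ⟩
  G (x ∷ []) +ₚ (G [] +ₚ sumₚ (map (λ y → G (y ∷ [])) L))
    ≈⟨ +ₚ-exchange (G (x ∷ [])) (G []) _ ⟩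
  G [] +ₚ sumₚ (map (λ y → G (y ∷ [])) (x ∷ L))
    ∎
  where
  open ≋-Reasoning
  onlyHead : (H : List _ → Poly) {L : List _} → All P L → (∀ y rest → P y → H (y ∷ rest) ≋ []) → sumSublists H L ≋ H []
  onlyHead H []        H-vanishes = +ₚ-identityʳ (H [])
  onlyHead H {y ∷ L} (py ∷ pL) H-vanishes = ≋-trans (sumSublists-∷ H y L)
    (≋-trans (+ₚ-cong (≋-trans (sumSublists-cong L λ p → H-vanishes y p py) (sumSublists-zero L)) (onlyHead H pL H-vanishes))
             ≋-refl)

*ₚ-weight-cong : ∀ {P Q} k C p → (nonAttacking p ≡ true → length p ≡ k → P ≋ Q) → P *ₚ weight k C p ≋ Q *ₚ weight k C p
*ₚ-weight-cong {P} {Q} k C p P≋Q with nonAttacking p | length p ≡ᵇ k in ℓ≡ᵇk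
... | false | _     = ≋-trans (*ₚ-zeroʳ P) (≋-sym (*ₚ-zeroʳ Q))
... | true  | false = ≋-trans (*ₚ-zeroʳ P) (≋-sym (*ₚ-zeroʳ Q))
... | true  | true  = *ₚ-cong (P≋Q refl (≡ᵇ-true⇒≡ ℓ≡ᵇk)) ≋-refl

weight-zero-∷ : ∀ C x p → weight zero C (x ∷ p) ≡ []
weight-zero-∷ C x p with nonAttacking (x ∷ p)
... | true  = refl
... | false = refl

weight-sameRow : ∀ k C {i j j′} p → weight k C ((i , j) ∷ (i , j′) ∷ p) ≡ []
weight-sameRow k C {i} {j} {j′} p rewrite ≡ᵇ-refl i = refl

cong₃ : ∀ {A B C D : Set} (f : A → B → C → D) {a a′ b b′ c c′} →
  a ≡ a′ → b ≡ b′ → c ≡ c′ → f a b c ≡ f a′ b′ c′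
cong₃ f refl refl refl = refl

countedBy : Bool → Bool → Bool → Bool
countedBy u v w = not u ∧ not v ∧ not w

Below : ℕ → Cell → Set
Below r y = (r <ᵇ proj₁ y) ≡ true

counted-∷-above : ∀ {r} c b {i j} → Below r (i , j) → counted ((r , c) ∷ b) (i , j) ≡ counted b (i , j)
counted-∷-above {r} c b {i} {j} r<i = cong₃ countedBy
  (cong (λ t → (t ∧ (j ≡ᵇ c)) ∨ anyB (cellEq (i , j)) b) (<ᵇ⇒≢ᵇ˘ r i r<i))
  (cong (λ t → (t ∧ (j <ᵇ c)) ∨ anyB (λ x → (proj₁ x ≡ᵇ i) ∧ (j <ᵇ proj₂ x)) b) (<ᵇ⇒≢ᵇ r i r<i))
  (cong (_∨ _) (trans (cong ((c ≡ᵇ j) ∧_) (<ᵇ-asym r i r<i)) (∧-zeroʳ _)))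

counted-above : ∀ {r} b → All (Below r) b → ∀ c → counted b (r , c) ≡ columnFree b c
counted-above {r} b b-below c = cong₃ countedBy
  (anyB-false (cellEq (r , c)) b-below λ y r<y → cong (_∧ (c ≡ᵇ proj₂ y)) (<ᵇ⇒≢ᵇ r (proj₁ y) r<y))
  (anyB-false (λ x → (proj₁ x ≡ᵇ r) ∧ (c <ᵇ proj₂ x)) b-below λ y r<y →
    cong (_∧ (c <ᵇ proj₂ y)) (<ᵇ⇒≢ᵇ˘ r (proj₁ y) r<y))
  (anyB-congᴬ b-below λ y r<y → trans (cong ((proj₂ y ≡ᵇ c) ∧_) r<y) (∧-identityʳ _))

counted-∷-sameRow : ∀ {r} c b → All (Below r) b → ∀ c′ → counted ((r , c) ∷ b) (r , c′) ≡ (c <ᵇ c′) ∧ columnFree b c′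
counted-∷-sameRow {r} c b b-below c′ = trans (cong₃ countedBy
  (trans (cong₂ (λ s t → (s ∧ (c′ ≡ᵇ c)) ∨ t) (≡ᵇ-refl r)
    (anyB-false (cellEq (r , c′)) b-below λ y r<y → cong (_∧ (c′ ≡ᵇ proj₂ y)) (<ᵇ⇒≢ᵇ r (proj₁ y) r<y))) (∨-identityʳ _))
  (trans (cong₂ (λ s t → (s ∧ (c′ <ᵇ c)) ∨ t) (≡ᵇ-refl r)
    (anyB-false (λ x → (proj₁ x ≡ᵇ r) ∧ (c′ <ᵇ proj₂ x)) b-below λ y r<y →
      cong (_∧ (c′ <ᵇ proj₂ y)) (<ᵇ⇒≢ᵇ˘ r (proj₁ y) r<y)))
    (∨-identityʳ _))
  (cong₂ _∨_ (trans (cong ((c ≡ᵇ c′) ∧_) (<ᵇ-irrefl r)) (∧-zeroʳ _))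
    (anyB-congᴬ b-below λ y r<y → trans (cong ((proj₂ y ≡ᵇ c′) ∧_) r<y) (∧-identityʳ _))))
  (trans (sym (∧-assoc (not (c′ ≡ᵇ c)) _ _)) (cong (_∧ columnFree b c′) (trichotomyᵇ c c′)))

nonAttacking-above : ∀ {r} c b → All (Below r) b → not (anyB (attacks (r , c)) b) ≡ columnFree b c
nonAttacking-above {r} c b b-below = cong not (anyB-congᴬ b-below λ y r<y →
  trans (cong (_∨ (c ≡ᵇ proj₂ y)) (<ᵇ⇒≢ᵇ r (proj₁ y) r<y)) (≡ᵇ-sym c (proj₂ y)))

inRow : ℕ → ℕ → Cell
inRow i j = (i , j)

UnderRow : ℕ → List ℕ → Cell → Set
UnderRow r cols y = Below r y × proj₂ y ∈ cols

-- A rook in the new row must avoid the m − (k − 1) columns used by the other rooks; weighted by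
-- q^(number of free columns to its right), these choices sum to [m − k + 1].
module AddRow (r : ℕ) (cols : List ℕ) (cols↑ : AllPairs _<_ cols)
              (B : List Cell) (B-under : All (UnderRow r cols) B) where

  A : List Cell
  A = map (inRow r) cols

  m : ℕ
  m = length cols

  below : ∀ {b} → All (UnderRow r cols) b → All (Below r) b
  below = All.map proj₁

  invOn-noRowRook : ∀ b → All (UnderRow r cols) b → invOn (A ++ B) b ≡ count (columnFree b) cols + invOn B b
  invOn-noRowRook b b-under = trans (count-++ (counted b) A B)
    (cong (_+ invOn B b) (trans (count-map (counted b) (inRow r) cols) (count-cong cols (counted-above b (below b-under)))))

  invOn-rowRook : ∀ c b → All (UnderRow r cols) b →
    invOn (A ++ B) ((r , c) ∷ b) ≡ count (λ c′ → (c <ᵇ c′) ∧ columnFree b c′) cols + invOn B b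
  invOn-rowRook c b b-under = trans (count-++ (counted ((r , c) ∷ b)) A B)
    (cong₂ _+_ (trans (count-map _ (inRow r) cols) (count-cong cols (counted-∷-sameRow c b (below b-under))))
               (count-congᴬ (below B-under) λ y r<y → counted-∷-above c b r<y))

  count-columnFree : ∀ b → All (UnderRow r cols) b → nonAttacking b ≡ true → count (columnFree b) cols ≡ m ∸ length b
  count-columnFree b b-under na = trans (sym (m+n∸n≡m _ (length b)))
    (cong (_∸ length b) (count-columnFree+length b cols cols↑ na (All.map proj₂ b-under)))

  weight-noRowRook : ∀ k b → All (UnderRow r cols) b → weight k (A ++ B) b ≋ qpow (m ∸ k) *ₚ weight k B b
  weight-noRowRook k b b-under = weight-scaled k B (A ++ B) b (m ∸ k) λ na ℓ≡k →
    trans (invOn-noRowRook b b-under) (cong (_+ invOn B b) (trans (count-columnFree b b-under na) (cong (m ∸_) ℓ≡k)))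

  sum-weight-rowRook : ∀ k b → All (UnderRow r cols) b →
    sumₚ (map (λ c → weight k (A ++ B) ((r , c) ∷ b)) cols) ≋ qint (suc m ∸ k) *ₚ weight₋₁ k B b
  sum-weight-rowRook zero    b b-under =
    ≋-trans (sumₚ-map-zero cols λ c → ≡⇒≋ (weight-zero-∷ (A ++ B) (r , c) b)) (≋-sym (*ₚ-zeroʳ (qint (suc m))))
  sum-weight-rowRook (suc k) b b-under = begin
    sumₚ (map (λ c → weight (suc k) (A ++ B) ((r , c) ∷ b)) cols)
      ≈⟨ sumₚ-map-cong cols (λ c → weight-∷-scaled k B (A ++ B) (r , c) b (columnFree b c) (countRight c)
                                    (nonAttacking-above c b (below b-under)) λ _ _ → invOn-rowRook c b b-under) ⟩
    sumₚ (map (λ c → rightFree c *ₚ weight k B b) cols)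
      ≈⟨ sumₚ-map-*ₚ (weight k B b) rightFree cols ⟨
    sumₚ (map rightFree cols) *ₚ weight k B b
      ≈⟨ *ₚ-cong (sumₚ-qpow-countRight≋qint (columnFree b) cols cols↑) ≋-refl ⟩
    qint (count (columnFree b) cols) *ₚ weight k B b
      ≈⟨ *ₚ-weight-cong k B b (λ na ℓ≡k → ≡⇒≋ (cong qint (trans (count-columnFree b b-under na) (cong (m ∸_) ℓ≡k)))) ⟩
    qint (m ∸ k) *ₚ weight k B b
      ∎
    where
    open ≋-Reasoning
    countRight : ℕ → ℕ
    countRight c = count (λ c′ → (c <ᵇ c′) ∧ columnFree b c′) cols
    rightFree : ℕ → Poly
    rightFree c = if columnFree b c then qpow (countRight c) else []

  Rb-addRow : ∀ k → Rb k (A ++ B) ≋ qpow (m ∸ k) *ₚ Rb k B +ₚ qint (suc m ∸ k) *ₚ Rb₋₁ k B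
  Rb-addRow k = begin
    Rb k (A ++ B)                                                 ≈⟨ Rb≋sumSublists k (A ++ B) ⟩
    sumSublists (weight k (A ++ B)) (A ++ B)                      ≈⟨ sumSublists-++ (weight k (A ++ B)) A B ⟩
    sumSublists extending A                                       ≈⟨ sumSublists-atMostOne extending A-inRow twoRowRooks ⟩
    extending [] +ₚ sumₚ (map (λ x → extending (x ∷ [])) A)      ≈⟨ +ₚ-cong noRowRook oneRowRook ⟩
    qpow (m ∸ k) *ₚ Rb k B +ₚ qint (suc m ∸ k) *ₚ Rb₋₁ k B        ∎
    where
    open ≋-Reasoning
    extending : List Cell → Poly
    extending a = sumSublists (λ b → weight k (A ++ B) (a ++ b)) B

    A-inRow : All (λ x → proj₁ x ≡ r) A
    A-inRow = All.map⁺ (All.tabulate λ _ → refl)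

    twoRowRooks : ∀ x y rest → proj₁ x ≡ r → proj₁ y ≡ r → extending (x ∷ y ∷ rest) ≋ []
    twoRowRooks (_ , j) (_ , j′) rest refl refl =
      ≋-trans (sumSublists-cong B λ b → ≡⇒≋ (weight-sameRow k (A ++ B) {r} {j} {j′} (rest ++ b))) (sumSublists-zero B)

    noRowRook : extending [] ≋ qpow (m ∸ k) *ₚ Rb k B
    noRowRook = begin
      sumSublists (weight k (A ++ B)) B                      ≈⟨ sumSublists-congᴬ B-under (weight-noRowRook k) ⟩
      sumSublists (λ b → qpow (m ∸ k) *ₚ weight k B b) B     ≈⟨ *ₚ-sumₚ-map (qpow (m ∸ k)) (weight k B) (sublists B) ⟨
      qpow (m ∸ k) *ₚ sumSublists (weight k B) B             ≈⟨ *ₚ-congˡ (qpow (m ∸ k)) (Rb≋sumSublists k B) ⟨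
      qpow (m ∸ k) *ₚ Rb k B                                 ∎

    oneRowRook : sumₚ (map (λ x → extending (x ∷ [])) A) ≋ qint (suc m ∸ k) *ₚ Rb₋₁ k B
    oneRowRook = begin
      sumₚ (map (λ x → extending (x ∷ [])) A)
        ≈⟨ sumₚ-map-∘ (λ x → extending (x ∷ [])) (inRow r) cols ⟩
      sumₚ (map (λ c → sumSublists (λ b → weight k (A ++ B) ((r , c) ∷ b)) B) cols)
        ≈⟨ sumₚ-map-sum-comm (λ c b → weight k (A ++ B) ((r , c) ∷ b)) cols (sublists B) ⟩
      sumSublists (λ b → sumₚ (map (λ c → weight k (A ++ B) ((r , c) ∷ b)) cols)) B
        ≈⟨ sumSublists-congᴬ B-under (sum-weight-rowRook k) ⟩
      sumSublists (λ b → qint (suc m ∸ k) *ₚ weight₋₁ k B b) B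
        ≈⟨ *ₚ-sumₚ-map (qint (suc m ∸ k)) (weight₋₁ k B) (sublists B) ⟨
      qint (suc m ∸ k) *ₚ sumSublists (weight₋₁ k B) B
        ≈⟨ *ₚ-congˡ (qint (suc m ∸ k)) (Rb₋₁≋sumSublists k B) ⟨
      qint (suc m ∸ k) *ₚ Rb₋₁ k B
        ∎

-- Removing a row or a column of a partition

range : ℕ → ℕ → List ℕ
range s zero    = []
range s (suc n) = s ∷ range (suc s) n

range-bounds : ∀ s n → All (λ i → s ≤ i × i < s + n) (range s n)
range-bounds s zero    = []
range-bounds s (suc n) = (≤-refl , m<m+n s z<s) ∷
  All.map (λ (s<i , i<) → <⇒≤ s<i , ≤-trans i< (≤-reflexive (sym (+-suc s n)))) (range-bounds (suc s) n)

range-↑ : ∀ s n → AllPairs _<_ (range s n)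
range-↑ s zero    = []
range-↑ s (suc n) = All.map proj₁ (range-bounds (suc s) n) ∷ range-↑ (suc s) n

∈-range : ∀ s n {i} → s ≤ i → i < s + n → i ∈ range s n
∈-range s zero    s≤i i< = ⊥-elim (<-irrefl refl (≤-trans i< (≤-trans (≤-reflexive (+-identityʳ s)) s≤i)))
∈-range s (suc n) {i} s≤i i< with s ≟ i
... | yes refl = here refl
... | no  s≢i  = there (∈-range (suc s) n (≤∧≢⇒< s≤i s≢i) (≤-trans i< (≤-reflexive (+-suc s n))))

length-range : ∀ s n → length (range s n) ≡ n
length-range s zero    = refl
length-range s (suc n) = cong suc (length-range (suc s) n)

range-suc : ∀ s n → range (suc s) n ≡ map suc (range s n)
range-suc s zero    = refl
range-suc s (suc n) = cong (suc s ∷_) (range-suc (suc s) n)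

applyUpTo-range : ∀ (f : ℕ → ℕ) s n → (∀ t → f t ≡ s + t) → applyUpTo f n ≡ range s n
applyUpTo-range f s zero    f≗s+ = refl
applyUpTo-range f s (suc n) f≗s+ = cong₂ _∷_ (trans (f≗s+ 0) (+-identityʳ s))
  (applyUpTo-range (f ∘ suc) (suc s) n λ t → trans (f≗s+ (suc t)) (+-suc s t))

shiftRow : Cell → Cell
shiftRow (i , j) = (suc i , j)

shiftColumn : Cell → Cell
shiftColumn (i , j) = (i , suc j)

transpose : Cell → Cell
transpose (i , j) = (j , i)

module RelabelShiftRow = Relabel shiftRow (λ _ _ → refl)
  (λ p c → cong₃ countedBy (anyB-map _ shiftRow p) (anyB-map _ shiftRow p) (anyB-map _ shiftRow p))

module RelabelShiftColumn = Relabel shiftColumn (λ _ _ → refl)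
  (λ p c → cong₃ countedBy (anyB-map _ shiftColumn p) (anyB-map _ shiftColumn p) (anyB-map _ shiftColumn p))

-- Transposition exchanges the "left of" and "above" conditions in the inversion statistic.
counted-transpose : ∀ p c → counted (map transpose p) (transpose c) ≡ counted p c
counted-transpose p (i , j) = trans
  (cong₃ countedBy (trans (anyB-map _ transpose p) (anyB-cong p λ y → ∧-comm (j ≡ᵇ proj₂ y) _))
                   (anyB-map _ transpose p) (anyB-map _ transpose p))
  (∧-exchange (not (anyB (cellEq (i , j)) p)) (not (anyB (λ r → (proj₂ r ≡ᵇ j) ∧ (i <ᵇ proj₁ r)) p))
              (not (anyB (λ r → (proj₁ r ≡ᵇ i) ∧ (j <ᵇ proj₂ r)) p)))
  where
  ∧-exchange : ∀ a b c → a ∧ b ∧ c ≡ a ∧ c ∧ b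
  ∧-exchange true  b c = ∧-comm b c
  ∧-exchange false b c = refl

module RelabelTranspose = Relabel transpose (λ x y → ∨-comm (proj₂ x ≡ᵇ proj₂ y) _) counted-transpose

cellsFrom-shiftRow : ∀ s xs → cellsFrom (suc s) xs ≡ map shiftRow (cellsFrom s xs)
cellsFrom-shiftRow s []       = refl
cellsFrom-shiftRow s (x ∷ xs) = trans (cong₂ _++_ (map-∘ {g = shiftRow} {f = λ j → (s , suc j)} (upTo x)) (cellsFrom-shiftRow (suc s) xs))
  (sym (map-++ shiftRow (map (λ j → (s , suc j)) (upTo x)) (cellsFrom (suc s) xs)))

rowCells≡ : ∀ s x → map (λ j → (s , suc j)) (upTo x) ≡ map (inRow s) (range 1 x)
rowCells≡ s x = trans (map-applyUpTo id (λ j → (s , suc j)) x)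
  (trans (sym (map-applyUpTo suc (inRow s) x)) (cong (map (inRow s)) (applyUpTo-range suc 1 x λ _ → refl)))

cellsFrom-bounds : ∀ s xs → All (λ c → s ≤ proj₁ c × proj₁ c < s + length xs × 1 ≤ proj₂ c) (cellsFrom s xs)
cellsFrom-bounds s []       = []
cellsFrom-bounds s (x ∷ xs) = All.++⁺ (All.map⁺ (All.applyUpTo⁺₂ id x λ _ → ≤-refl , m<m+n s z<s , s≤s z≤n))
  (All.map (λ (s<i , i< , 1≤j) → <⇒≤ s<i , ≤-trans i< (≤-reflexive (sym (+-suc s (length xs)))) , 1≤j)
           (cellsFrom-bounds (suc s) xs))

cellsFrom-columns≤ : ∀ s m xs → All (_≤ m) xs → All (λ c → proj₂ c ≤ m) (cellsFrom s xs)
cellsFrom-columns≤ s m []       []           = []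
cellsFrom-columns≤ s m (x ∷ xs) (x≤m ∷ xs≤m) =
  All.++⁺ (All.map⁺ (All.applyUpTo⁺₁ id x λ j<x → ≤-trans j<x x≤m)) (cellsFrom-columns≤ (suc s) m xs xs≤m)

R-∷ : ∀ k m ν → All (_≤ m) ν → R k (m ∷ ν) ≋ qpow (m ∸ k) *ₚ R k ν +ₚ qint (suc m ∸ k) *ₚ Rb₋₁ k (cells ν)
R-∷ k m ν ν≤m = begin
  Rb k (cells (m ∷ ν))
    ≡⟨ cong (Rb k) (cong₂ _++_ (rowCells≡ 1 m) (cellsFrom-shiftRow 1 ν)) ⟩
  Rb k (map (inRow 1) (range 1 m) ++ map shiftRow (cells ν))
    ≈⟨ AddRow.Rb-addRow 1 (range 1 m) (range-↑ 1 m) (map shiftRow (cells ν)) under k ⟩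
  qpow (length (range 1 m) ∸ k) *ₚ Rb k (map shiftRow (cells ν)) +ₚ
  qint (suc (length (range 1 m)) ∸ k) *ₚ Rb₋₁ k (map shiftRow (cells ν))
    ≈⟨ +ₚ-cong (*ₚ-cong (≡⇒≋ (cong (λ n → qpow (n ∸ k)) (length-range 1 m))) (RelabelShiftRow.Rb-map k (cells ν)))
               (*ₚ-cong (≡⇒≋ (cong (λ n → qint (suc n ∸ k)) (length-range 1 m))) (RelabelShiftRow.Rb₋₁-map k (cells ν))) ⟩
  qpow (m ∸ k) *ₚ R k ν +ₚ qint (suc m ∸ k) *ₚ Rb₋₁ k (cells ν)
    ∎
  where
  open ≋-Reasoning
  under : All (UnderRow 1 (range 1 m)) (map shiftRow (cells ν))
  under = All.map⁺ (All.zipWith (λ { {suc i , j} ((_ , _ , 1≤j) , j≤m) → refl , ∈-range 1 m 1≤j (s≤s j≤m) })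
                                (cellsFrom-bounds 1 ν , cellsFrom-columns≤ 1 m ν ν≤m))

cellsFrom-map-suc-↭ : ∀ s ν →
  cellsFrom s (map suc ν) ↭ map (λ i → (i , 1)) (range s (length ν)) ++ map shiftColumn (cellsFrom s ν)
cellsFrom-map-suc-↭ s []      = ↭.refl
cellsFrom-map-suc-↭ s (x ∷ ν) = subst (cellsFrom s (map suc (x ∷ ν)) ↭_) (sym rhs≡)
  (↭.prep (s , 1) (↭.trans (++⁺ˡ row (cellsFrom-map-suc-↭ (suc s) ν))
                           (subst (λ t → row ++ column ++ rest ↭ column ++ t ++ rest) row≡ (shifts row column))))
  where
  row    = map (λ j → (s , suc j)) (applyUpTo suc x)
  column = map (λ i → (i , 1)) (range (suc s) (length ν))
  rest   = map shiftColumn (cellsFrom (suc s) ν)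
  row≡ : row ≡ map shiftColumn (map (λ j → (s , suc j)) (upTo x))
  row≡ = trans (map-applyUpTo suc (λ j → (s , suc j)) x)
    (trans (sym (map-applyUpTo id (λ j → (s , suc (suc j))) x)) (map-∘ {g = shiftColumn} {f = λ j → (s , suc j)} (upTo x)))
  rhs≡ : map (λ i → (i , 1)) (range s (suc (length ν))) ++ map shiftColumn (cellsFrom s (x ∷ ν))
       ≡ (s , 1) ∷ column ++ map shiftColumn (map (λ j → (s , suc j)) (upTo x)) ++ rest
  rhs≡ = cong (λ t → (s , 1) ∷ column ++ t) (map-++ shiftColumn (map (λ j → (s , suc j)) (upTo x)) (cellsFrom (suc s) ν))

-- Transposition turns the first column into a top row.
R-map-suc : ∀ k ν →
  R k (map suc ν) ≋ qpow (length ν ∸ k) *ₚ R k ν +ₚ qint (suc (length ν) ∸ k) *ₚ Rb₋₁ k (cells ν)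
R-map-suc k ν = begin
  Rb k (cells (map suc ν))
    ≈⟨ Rb-↭ k (cellsFrom-map-suc-↭ 1 ν) ⟩
  Rb k (column ++ map shiftColumn (cells ν))
    ≈⟨ RelabelTranspose.Rb-map k (column ++ map shiftColumn (cells ν)) ⟨
  Rb k (map transpose (column ++ map shiftColumn (cells ν)))
    ≡⟨ cong (Rb k) (trans (map-++ transpose column (map shiftColumn (cells ν)))
                          (cong (_++ B) (sym (map-∘ {g = transpose} {f = λ i → (i , 1)} (range 1 n))))) ⟩
  Rb k (map (inRow 1) (range 1 n) ++ B)
    ≈⟨ AddRow.Rb-addRow 1 (range 1 n) (range-↑ 1 n) B under k ⟩
  qpow (length (range 1 n) ∸ k) *ₚ Rb k B +ₚ qint (suc (length (range 1 n)) ∸ k) *ₚ Rb₋₁ k B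
    ≈⟨ +ₚ-cong (*ₚ-cong (≡⇒≋ (cong (λ l → qpow (l ∸ k)) (length-range 1 n)))
                        (untranspose RelabelTranspose.Rb-map RelabelShiftColumn.Rb-map))
               (*ₚ-cong (≡⇒≋ (cong (λ l → qint (suc l ∸ k)) (length-range 1 n)))
                        (untranspose RelabelTranspose.Rb₋₁-map RelabelShiftColumn.Rb₋₁-map)) ⟩
  qpow (n ∸ k) *ₚ R k ν +ₚ qint (suc n ∸ k) *ₚ Rb₋₁ k (cells ν)
    ∎
  where
  open ≋-Reasoning
  n = length ν
  column = map (λ i → (i , 1)) (range 1 n)
  B = map transpose (map shiftColumn (cells ν))
  untranspose : {F : ℕ → List Cell → Poly} →
    (∀ k C → F k (map transpose C) ≋ F k C) → (∀ k C → F k (map shiftColumn C) ≋ F k C) →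
    F k B ≋ F k (cells ν)
  untranspose F-transpose F-shift = ≋-trans (F-transpose k (map shiftColumn (cells ν))) (F-shift k (cells ν))
  under : All (UnderRow 1 (range 1 n)) B
  under = All.map⁺ (All.map⁺ (All.map (λ { {i , suc j} (1≤i , i< , _) → refl , ∈-range 1 n 1≤i i< }) (cellsFrom-bounds 1 ν)))

Decreasing : List ℕ → Set
Decreasing = AllPairs _≥_

Zeros : List ℕ → Set
Zeros = All (_≡ 0)

Decreasing-map : ∀ {f : ℕ → ℕ} → (∀ {a b} → a ≥ b → f a ≥ f b) → ∀ {xs} → Decreasing xs → Decreasing (map f xs)
Decreasing-map f-mono = AllPairs.map⁺ ∘ AllPairs.map f-mono

Decreasing-dropZeros : ∀ {xs} → Decreasing xs → Decreasing (dropZeros xs)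
Decreasing-dropZeros = AllPairs.filter⁺ (1 ≤?_)

dropZeros-zeros : ∀ {zs} → Zeros zs → dropZeros zs ≡ []
dropZeros-zeros zs≡0 = filter-none (1 ≤?_) (All.map (λ { refl () }) zs≡0)

dropZeros-map-suc : ∀ xs → dropZeros (map suc xs) ≡ map suc xs
dropZeros-map-suc xs = filter-all (1 ≤?_) (All.map⁺ (All.universal (λ _ → s≤s z≤n) xs))

dropZeros-positive : ∀ xs → dropZeros xs ≡ map suc (map pred (dropZeros xs))
dropZeros-positive []          = refl
dropZeros-positive (zero  ∷ xs) = dropZeros-positive xs
dropZeros-positive (suc x ∷ xs) = cong (suc x ∷_) (dropZeros-positive xs)

zeros-split : ∀ μ → Decreasing μ → Σ (List ℕ) λ zs → Zeros zs × μ ≡ dropZeros μ ++ zs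
zeros-split []           []           = [] , [] , refl
zeros-split (zero  ∷ xs) (0≥xs ∷ _)   =
  zero ∷ xs , refl ∷ xs≡0 , cong (_++ zero ∷ xs) (sym (dropZeros-zeros xs≡0))
  where xs≡0 = All.map (λ { z≤n → refl }) 0≥xs
zeros-split (suc x ∷ xs) (_ ∷ xs↓) with zeros-split xs xs↓
... | zs , zs≡0 , xs≡ = zs , zs≡0 , cong (suc x ∷_) xs≡

cellsFrom-zeros : ∀ s {zs} → Zeros zs → cellsFrom s zs ≡ []
cellsFrom-zeros s []            = refl
cellsFrom-zeros s (refl ∷ zs≡0) = cellsFrom-zeros (suc s) zs≡0

cellsFrom-++-zeros : ∀ s xs {zs} → Zeros zs → cellsFrom s (xs ++ zs) ≡ cellsFrom s xs
cellsFrom-++-zeros s []       zs≡0 = cellsFrom-zeros s zs≡0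
cellsFrom-++-zeros s (x ∷ xs) zs≡0 = cong (map (λ j → (s , suc j)) (upTo x) ++_) (cellsFrom-++-zeros (suc s) xs zs≡0)

cells-dropZeros : ∀ μ → Decreasing μ → cells (dropZeros μ) ≡ cells μ
cells-dropZeros μ μ↓ with zeros-split μ μ↓
... | zs , zs≡0 , μ≡ = trans (sym (cellsFrom-++-zeros 1 (dropZeros μ) zs≡0)) (cong cells (sym μ≡))

R-dropZeros : ∀ k μ → Decreasing μ → R k (dropZeros μ) ≡ R k μ
R-dropZeros k μ μ↓ = cong (Rb k) (cells-dropZeros μ μ↓)

Rb₋₁-dropZeros : ∀ k μ → Decreasing μ → Rb₋₁ k (cells (dropZeros μ)) ≡ Rb₋₁ k (cells μ)
Rb₋₁-dropZeros k μ μ↓ = cong (Rb₋₁ k) (cells-dropZeros μ μ↓)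

All-deleteRow : ∀ {P : ℕ → Set} i {xs} → All P xs → All P (deleteRow i xs)
All-deleteRow i             []         = []
All-deleteRow zero          (px ∷ pxs) = px ∷ pxs
All-deleteRow (suc zero)    (px ∷ pxs) = pxs
All-deleteRow (suc (suc i)) (px ∷ pxs) = px ∷ All-deleteRow (suc i) pxs

Decreasing-deleteRow : ∀ i {xs} → Decreasing xs → Decreasing (deleteRow i xs)
Decreasing-deleteRow i             []         = []
Decreasing-deleteRow zero          (px ∷ pxs) = px ∷ pxs
Decreasing-deleteRow (suc zero)    (px ∷ pxs) = pxs
Decreasing-deleteRow (suc (suc i)) (px ∷ pxs) = All-deleteRow (suc i) px ∷ Decreasing-deleteRow (suc i) pxs

deleteRow-map : ∀ (f : ℕ → ℕ) i xs → deleteRow i (map f xs) ≡ map f (deleteRow i xs)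
deleteRow-map f i             []       = refl
deleteRow-map f zero          (x ∷ xs) = refl
deleteRow-map f (suc zero)    (x ∷ xs) = refl
deleteRow-map f (suc (suc i)) (x ∷ xs) = cong (f x ∷_) (deleteRow-map f (suc i) xs)

length-deleteRow : ∀ i x xs → 1 ≤ i → i ≤ suc (length xs) → length (deleteRow i (x ∷ xs)) ≡ length xs
length-deleteRow (suc zero)    x xs       _ _         = refl
length-deleteRow (suc (suc i)) x (y ∷ xs) _ (s≤s i≤) = cong suc (length-deleteRow (suc i) y xs (s≤s z≤n) i≤)

deleteRow-++ : ∀ i xs zs → 1 ≤ i → i ≤ length xs → deleteRow i (xs ++ zs) ≡ deleteRow i xs ++ zs
deleteRow-++ (suc zero)    (x ∷ xs) zs _ _        = refl
deleteRow-++ (suc (suc i)) (x ∷ xs) zs _ (s≤s i≤) = cong (x ∷_) (deleteRow-++ (suc i) xs zs (s≤s z≤n) i≤)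

shortenIfReaches : ℕ → ℕ → ℕ
shortenIfReaches j l = if j ≤ᵇ l then l ∸ 1 else l

shortenIfReaches-mono : ∀ j {a b} → a ≥ b → shortenIfReaches j a ≥ shortenIfReaches j b
shortenIfReaches-mono j {a} {b} a≥b with j ≤ᵇ a in j≤a | j ≤ᵇ b in j≤b
... | true  | true  = ∸-monoˡ-≤ 1 a≥b
... | false | false = a≥b
... | true  | false =
  ∸-monoˡ-≤ 1 (≤-trans (≰⇒> λ j≤b′ → subst T j≤b (≤⇒≤ᵇ j≤b′)) (≤ᵇ⇒≤ j a (subst T (sym j≤a) _)))
... | false | true  = ⊥-elim (subst T j≤a (≤⇒≤ᵇ (≤-trans (≤ᵇ⇒≤ j b (subst T (sym j≤b) _)) a≥b)))

Decreasing-deleteCol : ∀ j {xs} → Decreasing xs → Decreasing (deleteCol j xs)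
Decreasing-deleteCol j = Decreasing-map (shortenIfReaches-mono j)

deleteCol-zeros : ∀ j {zs} → Zeros zs → Zeros (deleteCol j zs)
deleteCol-zeros j             []            = []
deleteCol-zeros zero          (refl ∷ zs≡0) = refl ∷ deleteCol-zeros zero zs≡0
deleteCol-zeros (suc j)       (refl ∷ zs≡0) = refl ∷ deleteCol-zeros (suc j) zs≡0

deleteCol-1-map-suc : ∀ xs → deleteCol 1 (map suc xs) ≡ xs
deleteCol-1-map-suc []       = refl
deleteCol-1-map-suc (x ∷ xs) = cong (x ∷_) (deleteCol-1-map-suc xs)

deleteCol-suc-map-suc : ∀ j xs → 1 ≤ j → deleteCol (suc j) (map suc xs) ≡ map suc (deleteCol j xs)
deleteCol-suc-map-suc (suc j) []       _ = refl
deleteCol-suc-map-suc (suc j) (x ∷ xs) _ = cong₂ _∷_ (shift x) (deleteCol-suc-map-suc (suc j) xs (s≤s z≤n))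
  where
  shift : ∀ x → shortenIfReaches (suc (suc j)) (suc x) ≡ suc (shortenIfReaches (suc j) x)
  shift zero    = refl
  shift (suc x) with j <ᵇ suc x
  ... | true  = refl
  ... | false = refl

part-map-suc : ∀ μ i → 1 ≤ i → i ≤ length μ → part (map suc μ) i ≡ suc (part μ i)
part-map-suc (m ∷ ν) (suc zero)    _ _        = refl
part-map-suc (m ∷ ν) (suc (suc i)) _ (s≤s i≤) = part-map-suc ν (suc i) (s≤s z≤n) i≤

part-++ : ∀ xs zs i → 1 ≤ i → i ≤ length xs → part (xs ++ zs) i ≡ part xs i
part-++ (x ∷ xs) zs (suc zero)    _ _        = refl
part-++ (x ∷ xs) zs (suc (suc i)) _ (s≤s i≤) = part-++ xs zs (suc i) (s≤s z≤n) i≤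

cellTerm : ℕ → List ℕ → Cell → Poly
cellTerm k μ (i , j) = qpow ((i + part μ i) ∸ j) *ₚ R k (removeRC μ (i , j))

cellTerm₋₁ : ℕ → List ℕ → Cell → Poly
cellTerm₋₁ k μ (i , j) = qpow ((i + part μ i) ∸ j) *ₚ Rb₋₁ k (cells (removeRC μ (i , j)))

lhs₋₁ : ℕ → List ℕ → Poly
lhs₋₁ k μ = sumₚ (map (cellTerm₋₁ k μ) (cells μ))

removeRC-++-zeros : ∀ xs {zs} i j → Zeros zs → 1 ≤ i → i ≤ length xs → removeRC (xs ++ zs) (i , j) ≡ removeRC xs (i , j)
removeRC-++-zeros xs {zs} i j zs≡0 1≤i i≤ = begin
  dropZeros (deleteCol j (deleteRow i (xs ++ zs)))                     ≡⟨ cong (dropZeros ∘ deleteCol j) (deleteRow-++ i xs zs 1≤i i≤) ⟩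
  dropZeros (deleteCol j (deleteRow i xs ++ zs))                       ≡⟨ cong dropZeros (map-++ (shortenIfReaches j) (deleteRow i xs) zs) ⟩
  dropZeros (deleteCol j (deleteRow i xs) ++ deleteCol j zs)           ≡⟨ filter-++ (1 ≤?_) (deleteCol j (deleteRow i xs)) _ ⟩
  dropZeros (deleteCol j (deleteRow i xs)) ++ dropZeros (deleteCol j zs) ≡⟨ cong (_ ++_) (dropZeros-zeros (deleteCol-zeros j zs≡0)) ⟩
  dropZeros (deleteCol j (deleteRow i xs)) ++ []                       ≡⟨ ++-identityʳ _ ⟩
  dropZeros (deleteCol j (deleteRow i xs))                             ∎
  where open ≡-Reasoning

lhs-++-zeros : ∀ k xs {zs} → Zeros zs → lhs k (xs ++ zs) ≋ lhs k xs
lhs-++-zeros k xs {zs} zs≡0 = ≋-trans (≡⇒≋ (cong (sumₚ ∘ map (cellTerm k (xs ++ zs))) (cellsFrom-++-zeros 1 xs zs≡0)))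
  (sumₚ-map-congᴬ (cellsFrom-bounds 1 xs) λ { (i , j) (1≤i , s≤s i≤ , _) →
    ≡⇒≋ (cong₂ (λ p ρ → qpow ((i + p) ∸ j) *ₚ R k ρ) (part-++ xs zs i 1≤i i≤) (removeRC-++-zeros xs i j zs≡0 1≤i i≤)) })

lhs-dropZeros : ∀ k μ → Decreasing μ → lhs k μ ≋ lhs k (dropZeros μ)
lhs-dropZeros k μ μ↓ with zeros-split μ μ↓
... | zs , zs≡0 , μ≡ = ≋-trans (≡⇒≋ (cong (lhs k) μ≡)) (lhs-++-zeros k (dropZeros μ) zs≡0)

R-vanishes-rows : ∀ k ν → Decreasing ν → length ν < k → R k ν ≋ []
R-vanishes-rows (suc k) []      []          _  = ≋-refl
R-vanishes-rows k       (x ∷ ν) (x≥ν ∷ ν↓) ℓ<k = begin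
  R k (x ∷ ν)
    ≈⟨ R-∷ k x ν x≥ν ⟩
  qpow (x ∸ k) *ₚ R k ν +ₚ qint (suc x ∸ k) *ₚ Rb₋₁ k (cells ν)
    ≈⟨ +ₚ-cong (*ₚ-vanishing (R-vanishes-rows k ν ν↓ (<-trans (n<1+n _) ℓ<k)) (qpow (x ∸ k)))
               (*ₚ-vanishing (lower k ℓ<k) (qint (suc x ∸ k))) ⟩
  []
    ∎
  where
  open ≋-Reasoning
  lower : ∀ k → suc (length ν) < k → Rb₋₁ k (cells ν) ≋ []
  lower (suc k) (s≤s ℓ<k) = R-vanishes-rows k ν ν↓ ℓ<k

R-vanishes-columns : ∀ k m ν → Decreasing ν → All (_≤ m) ν → m < k → R k ν ≋ []
R-vanishes-columns (suc k) m []      []          []          _   = ≋-refl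
R-vanishes-columns k       m (x ∷ ν) (x≥ν ∷ ν↓) (x≤m ∷ ν≤m) m<k = begin
  R k (x ∷ ν)
    ≈⟨ R-∷ k x ν x≥ν ⟩
  qpow (x ∸ k) *ₚ R k ν +ₚ qint (suc x ∸ k) *ₚ Rb₋₁ k (cells ν)
    ≈⟨ +ₚ-cong (*ₚ-vanishing (R-vanishes-columns k m ν ν↓ ν≤m m<k) (qpow (x ∸ k)))
               (≡⇒≋ (cong (λ l → qint l *ₚ Rb₋₁ k (cells ν)) (m≤n⇒m∸n≡0 (≤-trans (s≤s x≤m) m<k)))) ⟩
  []
    ∎
  where open ≋-Reasoning

rowTerm : ℕ → List ℕ → ℕ → Poly
rowTerm k μ i = qpow (i + part μ i) *ₚ R k (deleteRow i μ)

rowTerm₋₁ : ℕ → List ℕ → ℕ → Poly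
rowTerm₋₁ k μ i = qpow (i + part μ i) *ₚ Rb₋₁ k (cells (deleteRow i μ))

rowDeletionSum : ℕ → List ℕ → Poly
rowDeletionSum k μ = sumₚ (map (rowTerm k μ) (range 1 (length μ)))

rowDeletionSum₋₁ : ℕ → List ℕ → Poly
rowDeletionSum₋₁ k μ = sumₚ (map (rowTerm₋₁ k μ) (range 1 (length μ)))

rowDeletionSum-∷ : ∀ k m ν → All (_≤ m) ν →
  rowDeletionSum k (m ∷ ν) ≋ qpow (suc m) *ₚ R k ν +ₚ
    ((qpow 1 *ₚ qpow (m ∸ k)) *ₚ rowDeletionSum k ν +ₚ (qpow 1 *ₚ qint (suc m ∸ k)) *ₚ rowDeletionSum₋₁ k ν)
rowDeletionSum-∷ k m ν ν≤m = +ₚ-cong ≋-refl (begin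
  sumₚ (map (rowTerm k (m ∷ ν)) (range 2 n))                        ≡⟨ cong (sumₚ ∘ map (rowTerm k (m ∷ ν))) (range-suc 1 n) ⟩
  sumₚ (map (rowTerm k (m ∷ ν)) (map suc (range 1 n)))             ≈⟨ sumₚ-map-∘ (rowTerm k (m ∷ ν)) suc (range 1 n) ⟩
  sumₚ (map (rowTerm k (m ∷ ν) ∘ suc) (range 1 n))                 ≈⟨ sumₚ-map-congᴬ (range-bounds 1 n) deleteLowerRow ⟩
  sumₚ (map (λ i → a *ₚ rowTerm k ν i +ₚ b *ₚ rowTerm₋₁ k ν i) (range 1 n))
                                                                    ≈⟨ sumₚ-map-+ₚ (λ i → a *ₚ rowTerm k ν i)
                                                                                  (λ i → b *ₚ rowTerm₋₁ k ν i) (range 1 n) ⟩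
  sumₚ (map (λ i → a *ₚ rowTerm k ν i) (range 1 n)) +ₚ sumₚ (map (λ i → b *ₚ rowTerm₋₁ k ν i) (range 1 n))
                                                                    ≈⟨ +ₚ-cong (*ₚ-sumₚ-map a (rowTerm k ν) (range 1 n))
                                                                               (*ₚ-sumₚ-map b (rowTerm₋₁ k ν) (range 1 n)) ⟨
  a *ₚ rowDeletionSum k ν +ₚ b *ₚ rowDeletionSum₋₁ k ν              ∎)
  where
  open ≋-Reasoning
  n = length ν
  a = qpow 1 *ₚ qpow (m ∸ k)
  b = qpow 1 *ₚ qint (suc m ∸ k)
  deleteLowerRow : ∀ i → 1 ≤ i × i < 1 + n → rowTerm k (m ∷ ν) (suc i) ≋ a *ₚ rowTerm k ν i +ₚ b *ₚ rowTerm₋₁ k ν i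
  deleteLowerRow (suc i) _ = ≋-trans
    (*ₚ-cong (≋-sym (qpow-+ 1 (suc i + part ν (suc i)))) (R-∷ k m (deleteRow (suc i) ν) (All-deleteRow (suc i) ν≤m)))
    (solve 6 (λ q e x y r r′ → (q :* e) :* (x :* r :+ y :* r′) := (q :* x) :* (e :* r) :+ (q :* y) :* (e :* r′)) ≋-refl
       (qpow 1) (qpow (suc i + part ν (suc i))) (qpow (m ∸ k)) (qint (suc m ∸ k))
       (R k (deleteRow (suc i) ν)) (Rb₋₁ k (cells (deleteRow (suc i) ν))))

topRow-identity : ∀ k m ν → Decreasing ν → All (_≤ m) ν →
  qpow (suc m) *ₚ R k ν +ₚ (qpow 1 *ₚ qpow (m ∸ k)) *ₚ (qpow (suc k) *ₚ qint (length ν ∸ k) *ₚ R k ν)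
  ≋ qpow (suc k) *ₚ qint (suc (length ν) ∸ k) *ₚ (qpow (m ∸ k) *ₚ R k ν)
topRow-identity k m ν ν↓ ν≤m = byCases (k ≤? m) (k ≤? n)
  where
  open ≋-Reasoning
  n  = length ν
  qk = qpow (suc k)
  qm = qpow (m ∸ k)
  I  = qint (n ∸ k)
  Left  = qpow (suc m) *ₚ R k ν +ₚ (qpow 1 *ₚ qm) *ₚ (qk *ₚ I *ₚ R k ν)
  Right = qk *ₚ qint (suc n ∸ k) *ₚ (qm *ₚ R k ν)

  vanishing : R k ν ≋ [] → Left ≋ Right
  vanishing R≋0 = ≋-trans
    (+ₚ-cong (*ₚ-vanishing R≋0 (qpow (suc m))) (*ₚ-vanishing (*ₚ-vanishing R≋0 (qk *ₚ I)) (qpow 1 *ₚ qm)))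
    (≋-sym (*ₚ-vanishing (*ₚ-vanishing R≋0 qm) (qk *ₚ qint (suc n ∸ k))))

  byCases : Dec (k ≤ m) → Dec (k ≤ n) → Left ≋ Right
  byCases (no k≰m)  _         = vanishing (R-vanishes-columns k m ν ν↓ ν≤m (≰⇒> k≰m))
  byCases (yes _)   (no k≰n)  = vanishing (R-vanishes-rows k ν ν↓ (≰⇒> k≰n))
  byCases (yes k≤m) (yes k≤n) = begin
    qpow (suc m) *ₚ R k ν +ₚ (qpow 1 *ₚ qm) *ₚ (qk *ₚ I *ₚ R k ν)
      ≈⟨ +ₚ-cong (*ₚ-congʳ (R k ν) (≋-trans (≡⇒≋ (cong (qpow ∘ suc) (sym (m+[n∸m]≡n k≤m))))
                                            (≋-sym (qpow-+ (suc k) (m ∸ k)))))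
                 ≋-refl ⟩
    qk *ₚ qm *ₚ R k ν +ₚ (qpow 1 *ₚ qm) *ₚ (qk *ₚ I *ₚ R k ν)
      ≈⟨ solve 5 (λ q a b i r → a :* b :* r :+ (q :* b) :* (a :* i :* r) := a :* (con 1 :+ q :* i) :* (b :* r)) ≋-refl
           (qpow 1) qk qm I (R k ν) ⟩
    qk *ₚ (qpow 0 +ₚ qpow 1 *ₚ I) *ₚ (qm *ₚ R k ν)
      ≈⟨ *ₚ-congʳ (qm *ₚ R k ν) (*ₚ-congˡ qk (≋-trans (≋-sym (qint-suc-shifted (n ∸ k)))
                                                    (≡⇒≋ (cong qint (sym (+-∸-assoc 1 k≤n)))))) ⟩
    qk *ₚ qint (suc n ∸ k) *ₚ (qm *ₚ R k ν)
      ∎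

rowDeletionSum-closed : ∀ k μ → Decreasing μ → rowDeletionSum k μ ≋ qpow (suc k) *ₚ qint (length μ ∸ k) *ₚ R k μ
rowDeletionSum₋₁-closed : ∀ k μ → Decreasing μ →
  rowDeletionSum₋₁ k μ ≋ qpow k *ₚ qint (suc (length μ) ∸ k) *ₚ Rb₋₁ k (cells μ)

rowDeletionSum-closed k []      []          = ≋-sym (*ₚ-congʳ (R k []) (*ₚ-vanishing (≡⇒≋ (cong qint (0∸n≡0 k))) (qpow (suc k))))
rowDeletionSum-closed k (m ∷ ν) (m≥ν ∷ ν↓) = begin
  rowDeletionSum k (m ∷ ν)
    ≈⟨ rowDeletionSum-∷ k m ν m≥ν ⟩
  qpow (suc m) *ₚ R k ν +ₚ (a *ₚ rowDeletionSum k ν +ₚ b *ₚ rowDeletionSum₋₁ k ν)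
    ≈⟨ +ₚ-congˡ (qpow (suc m) *ₚ R k ν) (+ₚ-cong (*ₚ-congˡ a (rowDeletionSum-closed k ν ν↓))
                                                (*ₚ-congˡ b (rowDeletionSum₋₁-closed k ν ν↓))) ⟩
  qpow (suc m) *ₚ R k ν +ₚ (a *ₚ (qk *ₚ I *ₚ R k ν) +ₚ b *ₚ (qpow k *ₚ I′ *ₚ P))
    ≈⟨ +ₚ-assoc (qpow (suc m) *ₚ R k ν) (a *ₚ (qk *ₚ I *ₚ R k ν)) _ ⟨
  qpow (suc m) *ₚ R k ν +ₚ a *ₚ (qk *ₚ I *ₚ R k ν) +ₚ b *ₚ (qpow k *ₚ I′ *ₚ P)
    ≈⟨ +ₚ-cong (topRow-identity k m ν ν↓ m≥ν) lowerRows ⟩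
  qk *ₚ I′ *ₚ (qm *ₚ R k ν) +ₚ qk *ₚ I′ *ₚ (Ia *ₚ P)
    ≈⟨ *ₚ-distribˡ (qk *ₚ I′) (qm *ₚ R k ν) (Ia *ₚ P) ⟨
  qk *ₚ I′ *ₚ (qm *ₚ R k ν +ₚ Ia *ₚ P)
    ≈⟨ *ₚ-congˡ (qk *ₚ I′) (R-∷ k m ν m≥ν) ⟨
  qk *ₚ I′ *ₚ R k (m ∷ ν)
    ∎
  where
  open ≋-Reasoning
  n  = length ν
  qk = qpow (suc k)
  qm = qpow (m ∸ k)
  Ia = qint (suc m ∸ k)
  I  = qint (n ∸ k)
  I′ = qint (suc n ∸ k)
  P  = Rb₋₁ k (cells ν)
  a  = qpow 1 *ₚ qm
  b  = qpow 1 *ₚ Ia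
  lowerRows : b *ₚ (qpow k *ₚ I′ *ₚ P) ≋ qk *ₚ I′ *ₚ (Ia *ₚ P)
  lowerRows = ≋-trans
    (solve 5 (λ q y x i p → (q :* y) :* (x :* i :* p) := (q :* x) :* i :* (y :* p)) ≋-refl (qpow 1) Ia (qpow k) I′ P)
    (*ₚ-congʳ (Ia *ₚ P) (*ₚ-congʳ I′ (qpow-+ 1 k)))

rowDeletionSum₋₁-closed zero    μ _  = ≋-trans (sumₚ-map-zero (range 1 (length μ)) λ i → *ₚ-zeroʳ (qpow (i + part μ i)))
                                               (≋-sym (*ₚ-zeroʳ (qpow 0 *ₚ qint (suc (length μ)))))
rowDeletionSum₋₁-closed (suc k) μ μ↓ = rowDeletionSum-closed k μ μ↓

-- Induction on the number of columns

cellTerm-firstColumn : ∀ k μ i → Decreasing μ → 1 ≤ i → i ≤ length μ → cellTerm k (map suc μ) (i , 1) ≡ rowTerm k μ i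
cellTerm-firstColumn k μ i μ↓ 1≤i i≤ = cong₂ _*ₚ_
  (cong qpow (trans (cong (λ p → (i + p) ∸ 1) (part-map-suc μ i 1≤i i≤)) (cong (_∸ 1) (+-suc i (part μ i)))))
  (trans (cong (R k ∘ dropZeros) (trans (cong (deleteCol 1) (deleteRow-map suc i μ)) (deleteCol-1-map-suc (deleteRow i μ))))
         (R-dropZeros k (deleteRow i μ) (Decreasing-deleteRow i μ↓)))

cellTerm-shiftColumn : ∀ k m ν i j → Decreasing (m ∷ ν) → 1 ≤ i → i ≤ suc (length ν) → 1 ≤ j →
  cellTerm k (map suc (m ∷ ν)) (i , suc j)
  ≋ qpow (length ν ∸ k) *ₚ cellTerm k (m ∷ ν) (i , j) +ₚ qint (suc (length ν) ∸ k) *ₚ cellTerm₋₁ k (m ∷ ν) (i , j)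
cellTerm-shiftColumn k m ν i j μ↓ 1≤i i≤ 1≤j = begin
  qpow ((i + part (map suc μ) i) ∸ suc j) *ₚ R k (removeRC (map suc μ) (i , suc j))
    ≡⟨ cong₂ _*ₚ_ (cong qpow exponent≡) (cong (R k) board≡) ⟩
  qpow e *ₚ R k (map suc Y)
    ≈⟨ *ₚ-congˡ (qpow e) (R-map-suc k Y) ⟩
  qpow e *ₚ (qpow (length Y ∸ k) *ₚ R k Y +ₚ qint (suc (length Y) ∸ k) *ₚ Rb₋₁ k (cells Y))
    ≈⟨ solve 5 (λ x y z u v → x :* (y :* u :+ z :* v) := y :* (x :* u) :+ z :* (x :* v)) ≋-refl
         (qpow e) (qpow (length Y ∸ k)) (qint (suc (length Y) ∸ k)) (R k Y) (Rb₋₁ k (cells Y)) ⟩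
  qpow (length Y ∸ k) *ₚ (qpow e *ₚ R k Y) +ₚ qint (suc (length Y) ∸ k) *ₚ (qpow e *ₚ Rb₋₁ k (cells Y))
    ≡⟨ cong₂ (λ l t → qpow (l ∸ k) *ₚ t +ₚ qint (suc l ∸ k) *ₚ (qpow e *ₚ Rb₋₁ k (cells Y)))
             length-Y (cong (qpow e *ₚ_) (sym (R-dropZeros k Y Y↓))) ⟩
  qpow (length ν ∸ k) *ₚ (qpow e *ₚ R k (dropZeros Y)) +ₚ qint (suc (length ν) ∸ k) *ₚ (qpow e *ₚ Rb₋₁ k (cells Y))
    ≡⟨ cong (λ t → qpow (length ν ∸ k) *ₚ (qpow e *ₚ R k (dropZeros Y)) +ₚ qint (suc (length ν) ∸ k) *ₚ (qpow e *ₚ t))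
            (sym (Rb₋₁-dropZeros k Y Y↓)) ⟩
  qpow (length ν ∸ k) *ₚ cellTerm k μ (i , j) +ₚ qint (suc (length ν) ∸ k) *ₚ cellTerm₋₁ k μ (i , j)
    ∎
  where
  open ≋-Reasoning
  μ = m ∷ ν
  e = (i + part μ i) ∸ j
  Y = deleteCol j (deleteRow i μ)
  Y↓ : Decreasing Y
  Y↓ = Decreasing-deleteCol j (Decreasing-deleteRow i μ↓)
  length-Y : length Y ≡ length ν
  length-Y = trans (length-map (shortenIfReaches j) (deleteRow i μ)) (length-deleteRow i m ν 1≤i i≤)
  exponent≡ : (i + part (map suc μ) i) ∸ suc j ≡ e
  exponent≡ = trans (cong (λ p → (i + p) ∸ suc j) (part-map-suc μ i 1≤i i≤)) (cong (_∸ suc j) (+-suc i (part μ i)))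
  board≡ : removeRC (map suc μ) (i , suc j) ≡ map suc Y
  board≡ = trans (cong (dropZeros ∘ deleteCol (suc j)) (deleteRow-map suc i μ))
    (trans (cong dropZeros (deleteCol-suc-map-suc j (deleteRow i μ) 1≤j)) (dropZeros-map-suc Y))

lhs-map-suc : ∀ k m ν → Decreasing (m ∷ ν) →
  lhs k (map suc (m ∷ ν)) ≋ rowDeletionSum k (m ∷ ν) +ₚ
    (qpow (length ν ∸ k) *ₚ lhs k (m ∷ ν) +ₚ qint (suc (length ν) ∸ k) *ₚ lhs₋₁ k (m ∷ ν))
lhs-map-suc k m ν μ↓ = begin
  sumₚ (map f (cells (map suc μ)))
    ≈⟨ sumₚ-map-↭ f (cellsFrom-map-suc-↭ 1 μ) ⟩
  sumₚ (map f (column ++ map shiftColumn (cells μ)))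
    ≡⟨ cong sumₚ (map-++ f column (map shiftColumn (cells μ))) ⟩
  sumₚ (map f column ++ map f (map shiftColumn (cells μ)))
    ≈⟨ sumₚ-++ (map f column) (map f (map shiftColumn (cells μ))) ⟩
  sumₚ (map f column) +ₚ sumₚ (map f (map shiftColumn (cells μ)))
    ≈⟨ +ₚ-cong firstColumn shiftedCells ⟩
  rowDeletionSum k μ +ₚ (qpow (n ∸ k) *ₚ lhs k μ +ₚ qint (suc n ∸ k) *ₚ lhs₋₁ k μ)
    ∎
  where
  open ≋-Reasoning
  μ = m ∷ ν
  n = length ν
  f = cellTerm k (map suc μ)
  column = map (λ i → (i , 1)) (range 1 (length μ))

  firstColumn : sumₚ (map f column) ≋ rowDeletionSum k μ
  firstColumn = ≋-trans (sumₚ-map-∘ f (λ i → (i , 1)) (range 1 (length μ)))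
    (sumₚ-map-congᴬ (range-bounds 1 (length μ)) λ i (1≤i , i<) → ≡⇒≋ (cellTerm-firstColumn k μ i μ↓ 1≤i (≤-pred i<)))

  shiftedCells : sumₚ (map f (map shiftColumn (cells μ))) ≋ qpow (n ∸ k) *ₚ lhs k μ +ₚ qint (suc n ∸ k) *ₚ lhs₋₁ k μ
  shiftedCells = begin
    sumₚ (map f (map shiftColumn (cells μ)))
      ≈⟨ sumₚ-map-∘ f shiftColumn (cells μ) ⟩
    sumₚ (map (f ∘ shiftColumn) (cells μ))
      ≈⟨ sumₚ-map-congᴬ (cellsFrom-bounds 1 μ) (λ { (i , j) (1≤i , i< , 1≤j) →
           cellTerm-shiftColumn k m ν i j μ↓ 1≤i (≤-pred i<) 1≤j }) ⟩
    sumₚ (map (λ c → qpow (n ∸ k) *ₚ cellTerm k μ c +ₚ qint (suc n ∸ k) *ₚ cellTerm₋₁ k μ c) (cells μ))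
      ≈⟨ sumₚ-map-+ₚ (λ c → qpow (n ∸ k) *ₚ cellTerm k μ c) (λ c → qint (suc n ∸ k) *ₚ cellTerm₋₁ k μ c) (cells μ) ⟩
    sumₚ (map (λ c → qpow (n ∸ k) *ₚ cellTerm k μ c) (cells μ)) +ₚ
    sumₚ (map (λ c → qint (suc n ∸ k) *ₚ cellTerm₋₁ k μ c) (cells μ))
      ≈⟨ +ₚ-cong (*ₚ-sumₚ-map (qpow (n ∸ k)) (cellTerm k μ) (cells μ))
                 (*ₚ-sumₚ-map (qint (suc n ∸ k)) (cellTerm₋₁ k μ) (cells μ)) ⟨
    qpow (n ∸ k) *ₚ lhs k μ +ₚ qint (suc n ∸ k) *ₚ lhs₋₁ k μ
      ∎

Identity : List ℕ → Set
Identity μ = ∀ k → lhs k μ ≋ qpow 1 *ₚ qint (suc k) *ₚ R (suc k) μ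

identity-[] : Identity []
identity-[] k = ≋-sym (*ₚ-zeroʳ (qpow 1 *ₚ qint (suc k)))

identity-dropZeros : ∀ μ → Decreasing μ → Identity (dropZeros μ) → Identity μ
identity-dropZeros μ μ↓ identity k = ≋-trans (lhs-dropZeros k μ μ↓)
  (≋-trans (identity k) (≡⇒≋ (cong (qpow 1 *ₚ qint (suc k) *ₚ_) (R-dropZeros (suc k) μ μ↓))))

lhs₋₁-identity : ∀ μ → Identity μ → ∀ k → lhs₋₁ k μ ≋ qpow 1 *ₚ qint k *ₚ R k μ
lhs₋₁-identity μ _        zero    = ≋-trans (sumₚ-map-zero (cells μ) λ { (i , j) → *ₚ-zeroʳ (qpow ((i + part μ i) ∸ j)) })
                                            (≋-sym (*ₚ-congʳ (R zero μ) (*ₚ-zeroʳ (qpow 1))))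
lhs₋₁-identity μ identity (suc k) = identity k

identity-map-suc : ∀ μ → Decreasing μ → Identity μ → Identity (map suc μ)
identity-map-suc []      _  _        = identity-[]
identity-map-suc (m ∷ ν) μ↓ identity k = begin
  lhs k (map suc μ)
    ≈⟨ lhs-map-suc k m ν μ↓ ⟩
  rowDeletionSum k μ +ₚ (qpow (n ∸ k) *ₚ lhs k μ +ₚ I *ₚ lhs₋₁ k μ)
    ≈⟨ +ₚ-cong (rowDeletionSum-closed k μ μ↓) (+ₚ-cong (*ₚ-congˡ (qpow (n ∸ k)) (identity k))
                                                      (*ₚ-congˡ I (lhs₋₁-identity μ identity k))) ⟩
  qpow (suc k) *ₚ I *ₚ R k μ +ₚ (qpow (n ∸ k) *ₚ (Q *ₚ R (suc k) μ) +ₚ I *ₚ (Q₀ *ₚ R k μ))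
    ≈⟨ solve 7 (λ qk q₀ q a i r₀ r₁ →
                  qk :* i :* r₀ :+ (a :* (q :* r₁) :+ i :* (q₀ :* r₀)) := q :* (a :* r₁) :+ (qk :+ q₀) :* (i :* r₀))
         ≋-refl (qpow (suc k)) Q₀ Q (qpow (n ∸ k)) I (R k μ) (R (suc k) μ) ⟩
  Q *ₚ (qpow (n ∸ k) *ₚ R (suc k) μ) +ₚ (qpow (suc k) +ₚ Q₀) *ₚ (I *ₚ R k μ)
    ≈⟨ +ₚ-congˡ (Q *ₚ (qpow (n ∸ k) *ₚ R (suc k) μ)) (*ₚ-congʳ (I *ₚ R k μ) Q-split) ⟨
  Q *ₚ (qpow (n ∸ k) *ₚ R (suc k) μ) +ₚ Q *ₚ (I *ₚ R k μ)
    ≈⟨ *ₚ-distribˡ Q (qpow (n ∸ k) *ₚ R (suc k) μ) (I *ₚ R k μ) ⟨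
  Q *ₚ (qpow (n ∸ k) *ₚ R (suc k) μ +ₚ I *ₚ R k μ)
    ≈⟨ *ₚ-congˡ Q (R-map-suc (suc k) μ) ⟨
  Q *ₚ R (suc k) (map suc μ)
    ∎
  where
  open ≋-Reasoning
  μ  = m ∷ ν
  n  = length ν
  I  = qint (suc n ∸ k)
  Q  = qpow 1 *ₚ qint (suc k)
  Q₀ = qpow 1 *ₚ qint k
  Q-split : Q ≋ qpow (suc k) +ₚ Q₀
  Q-split = ≋-trans (*ₚ-congˡ (qpow 1) (qint-suc k)) (≋-trans (*ₚ-distribˡ (qpow 1) (qpow k) (qint k)) (+ₚ-cong (qpow-+ 1 k) ≋-refl))

identity-decreasing : ∀ b μ → All (_≤ b) μ → Decreasing μ → Identity μ
identity-decreasing zero    μ μ≤0 μ↓ = identity-dropZeros μ μ↓ (subst Identity (sym (dropZeros-zeros μ≡0)) identity-[])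
  where μ≡0 = All.map (λ { z≤n → refl }) μ≤0
identity-decreasing (suc b) μ μ≤b μ↓ =
  identity-dropZeros μ μ↓ (subst Identity (sym (dropZeros-positive μ))
    (identity-map-suc μ′ μ′↓ (identity-decreasing b μ′ μ′≤b μ′↓)))
  where
  μ′ = map pred (dropZeros μ)
  μ′↓ : Decreasing μ′
  μ′↓ = Decreasing-map pred-mono-≤ (Decreasing-dropZeros μ↓)
  μ′≤b : All (_≤ b) μ′
  μ′≤b = All.map⁺ (All.map pred-mono-≤ (All.filter⁺ (1 ≤?_) μ≤b))

maximum : List ℕ → ℕ
maximum = foldr _⊔_ 0

All-≤-maximum : ∀ xs → All (_≤ maximum xs) xs
All-≤-maximum []       = []
All-≤-maximum (x ∷ xs) = m≤m⊔n x (maximum xs) ∷ All.map (λ x≤ → ≤-trans x≤ (m≤n⊔m x (maximum xs))) (All-≤-maximum xs)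

lemma3p5 : (λs : List ℕ) → IsPartition λs → (k : ℕ) →
    lhs k λs ≈ qpow 1 *ₚ qint (suc k) *ₚ R (suc k) λs
lemma3p5 λs (_ , λs-linked) k =
  coeff-≡ (identity-decreasing (maximum λs) λs (All-≤-maximum λs) (Linked⇒AllPairs (λ x≥y y≥z → ≤-trans y≥z x≥y) λs-linked) k)
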